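{- Let $\mathcal M$ be a countable non-standard model of $\mathrm{Th}(\mathbb N)$. Then $SR(\mathcal M)>\omega$.
   Context: $\mathrm{Th}(\mathbb N)$ is true arithmetic, the complete theory of the standard model of arithmetic. $SR(\mathcal M)$, the (parameterless) Scott rank, is the least countable ordinal $\alpha$ such that every automorphism orbit of a finite tuple of $\mathcal M$ is definable without parameters by a $\Sigma^{\mathrm{in}}_\alpha$ formula of $L_{\omega_1\omega}$. -}

module Defs where

open import Data.Nat using (ℕ; zero; suc; _+_)
import Data.Nat as N
open import Data.Fin using (Fin; splitAt)
import Data.Fin as F
open import Data.Sum using (_⊎_; inj₁; inj₂; [_,_]′)
open import Data.Product using (Σ; Σ-syntax; ∃; ∃-syntax; _×_; _,_)
open import Data.Empty using (⊥)
open import Relation.Nullary using (¬_)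
open import Relation.Binary.PropositionalEquality using (_≡_)
open import Function using (_∘_; _⇔_)

record Structure : Set₁ where
  field
    Carrier : Set
    zeroᴹ   : Carrier
    oneᴹ    : Carrier
    _+ᴹ_    : Carrier → Carrier → Carrier
    _*ᴹ_    : Carrier → Carrier → Carrier
    _<ᴹ_    : Carrier → Carrier → Set

open Structure public

ℕ-std : Structure
ℕ-std = record
  { Carrier = ℕ ; zeroᴹ = 0 ; oneᴹ = 1 ; _+ᴹ_ = _+_ ; _*ᴹ_ = N._*_ ; _<ᴹ_ = N._<_ }

data Term (k : ℕ) : Set where
  var  : Fin k → Term k
  `0   : Term k
  `1   : Term k
  _`+_ : Term k → Term k → Term k
  _`*_ : Term k → Term k → Term k

Env : Structure → ℕ → Set
Env M k = Fin k → Carrier M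

evalT : (M : Structure) {k : ℕ} → Env M k → Term k → Carrier M
evalT M ρ (var i)  = ρ i
evalT M ρ `0       = zeroᴹ M
evalT M ρ `1       = oneᴹ M
evalT M ρ (s `+ t) = _+ᴹ_ M (evalT M ρ s) (evalT M ρ t)
evalT M ρ (s `* t) = _*ᴹ_ M (evalT M ρ s) (evalT M ρ t)

ext1 : {C : Set} {k : ℕ} → C → (Fin k → C) → Fin (suc k) → C
ext1 a ρ F.zero    = a
ext1 a ρ (F.suc i) = ρ i

extN : {C : Set} (m : ℕ) {k : ℕ} → (Fin m → C) → (Fin k → C) → Fin (m + k) → C
extN m ys xs = [ ys , xs ]′ ∘ splitAt m

data FO (k : ℕ) : Set where
  _`≈_ : Term k → Term k → FO k
  _`<_ : Term k → Term k → FO k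
  `⊥   : FO k
  `¬_  : FO k → FO k
  _`∧_ : FO k → FO k → FO k
  _`∨_ : FO k → FO k → FO k
  _`⇒_ : FO k → FO k → FO k
  `∃_  : FO (suc k) → FO k
  `∀_  : FO (suc k) → FO k

SatFO : (M : Structure) {k : ℕ} → FO k → Env M k → Set
SatFO M (s `≈ t) ρ = evalT M ρ s ≡ evalT M ρ t
SatFO M (s `< t) ρ = _<ᴹ_ M (evalT M ρ s) (evalT M ρ t)
SatFO M `⊥       ρ = ⊥
SatFO M (`¬ φ)   ρ = ¬ SatFO M φ ρ
SatFO M (φ `∧ ψ) ρ = SatFO M φ ρ × SatFO M ψ ρ
SatFO M (φ `∨ ψ) ρ = SatFO M φ ρ ⊎ SatFO M ψ ρ
SatFO M (φ `⇒ ψ) ρ = SatFO M φ ρ → SatFO M ψ ρ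
SatFO M (`∃ φ)   ρ = Σ[ a ∈ Carrier M ] SatFO M φ (ext1 a ρ)
SatFO M (`∀ φ)   ρ = (a : Carrier M) → SatFO M φ (ext1 a ρ)

emptyEnv : (M : Structure) → Env M 0
emptyEnv M ()

ModelOfTA : Structure → Set
ModelOfTA M = (φ : FO 0) → SatFO ℕ-std φ (emptyEnv ℕ-std) ⇔ SatFO M φ (emptyEnv M)

Countable : Structure → Set
Countable M = Σ[ e ∈ (ℕ → Carrier M) ] ((a : Carrier M) → ∃[ n ] e n ≡ a)

numeral : ℕ → Term 0
numeral zero    = `0
numeral (suc n) = numeral n `+ `1

NonStandard : Structure → Set
NonStandard M = ∃[ a ] ((n : ℕ) → ¬ (evalT M (emptyEnv M) (numeral n) ≡ a))

record Automorphism (M : Structure) : Set where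
  field
    h       : Carrier M → Carrier M
    h⁻¹     : Carrier M → Carrier M
    left    : ∀ a → h⁻¹ (h a) ≡ a
    right   : ∀ a → h (h⁻¹ a) ≡ a
    pres-0  : h (zeroᴹ M) ≡ zeroᴹ M
    pres-1  : h (oneᴹ M) ≡ oneᴹ M
    pres-+  : ∀ a b → h (_+ᴹ_ M a b) ≡ _+ᴹ_ M (h a) (h b)
    pres-*  : ∀ a b → h (_*ᴹ_ M a b) ≡ _*ᴹ_ M (h a) (h b)
    pres-<  : ∀ a b → _<ᴹ_ M a b ⇔ _<ᴹ_ M (h a) (h b)

InOrbit : (M : Structure) {k : ℕ} → Env M k → Env M k → Set
InOrbit M a b = Σ[ f ∈ Automorphism M ] (∀ i → Automorphism.h f (a i) ≡ b i)

data Ord : Set where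
  fin : ℕ → Ord
  ω   : Ord

data _<o_ : Ord → Ord → Set where
  fin<fin : ∀ {m n} → m N.< n → fin m <o fin n
  fin<ω   : ∀ {m} → fin m <o ω

data QF (k : ℕ) : Set where
  _`≈_ : Term k → Term k → QF k
  _`<_ : Term k → Term k → QF k
  `¬_  : QF k → QF k
  _`∧_ : QF k → QF k → QF k
  _`∨_ : QF k → QF k → QF k

SatQF : (M : Structure) {k : ℕ} → QF k → Env M k → Set
SatQF M (s `≈ t) ρ = evalT M ρ s ≡ evalT M ρ t
SatQF M (s `< t) ρ = _<ᴹ_ M (evalT M ρ s) (evalT M ρ t)
SatQF M (`¬ φ)   ρ = ¬ SatQF M φ ρ
SatQF M (φ `∧ ψ) ρ = SatQF M φ ρ × SatQF M ψ ρ
SatQF M (φ `∨ ψ) ρ = SatQF M φ ρ ⊎ SatQF M ψ ρ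

-- Σ^in_α and Π^in_α formulas of L_{ω₁ω}, α ≤ ω, with k free variables.
-- Σ^in_α (α > 0): countable disjunction ⋁_i ∃ȳ_i φ_i, φ_i ∈ Π^in_{β_i}, β_i < α.
-- Π^in_α (α > 0): countable conjunction ⋀_i ∀ȳ_i φ_i, φ_i ∈ Σ^in_{β_i}, β_i < α.
-- (countable families are indexed by ℕ; finite/empty ones are obtained by
--  repetition / a false or true disjunct.)

data Σin : Ord → ℕ → Set
data Πin : Ord → ℕ → Set

data Σin where
  σqf : ∀ {k} → QF k → Σin (fin 0) k
  ⋁∃  : ∀ {α k} (β : ℕ → Ord) → (∀ i → β i <o α) → (m : ℕ → ℕ)
        → ((i : ℕ) → Πin (β i) (m i + k)) → Σin α k

data Πin where
  πqf : ∀ {k} → QF k → Πin (fin 0) k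
  ⋀∀  : ∀ {α k} (β : ℕ → Ord) → (∀ i → β i <o α) → (m : ℕ → ℕ)
        → ((i : ℕ) → Σin (β i) (m i + k)) → Πin α k

SatΣ : (M : Structure) {α : Ord} {k : ℕ} → Σin α k → Env M k → Set
SatΠ : (M : Structure) {α : Ord} {k : ℕ} → Πin α k → Env M k → Set
SatΣ M (σqf φ) ρ = SatQF M φ ρ
SatΣ M (⋁∃ β _ m φ) ρ =
  Σ[ i ∈ ℕ ] Σ[ ys ∈ (Fin (m i) → Carrier M) ] SatΠ M (φ i) (extN (m i) ys ρ)
SatΠ M (πqf φ) ρ = SatQF M φ ρ
SatΠ M (⋀∀ β _ m φ) ρ =
  (i : ℕ) (ys : Fin (m i) → Carrier M) → SatΣ M (φ i) (extN (m i) ys ρ)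

OrbitsΣDefinable : Structure → Ord → Set
OrbitsΣDefinable M α =
  (k : ℕ) (a : Env M k) →
  Σ[ φ ∈ Σin α k ] ((b : Env M k) → SatΣ M φ b ⇔ InOrbit M a b)

-- SR(M) ≤ α  iff the orbits are Σ^in_α-definable; SR(M) > ω is its negation
ScottRank>ω : Structure → Set
ScottRank>ω M = ¬ OrbitsΣDefinable M ω

{-# OPTIONS --safe #-}

-- Let a be a nonstandard element of M.  A Σ^in_ω formula satisfied by a has a disjunct
-- ∃ȳ ψ that holds at a, with ψ in Π^in_r for some finite r.  It is enough to find b
-- that satisfies ∃ȳ ψ too but has another first-order type than a: it is not in the
-- orbit of a.
--
-- On ℕ, the n-round back-and-forth relations with accuracy m (only m entries of each
-- coded sequence are compared) are definable and have finitely many classes.  So every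
-- large x is equivalent, at its best accuracy m(x), to a smaller number; let p(x) be the
-- least one.  The parity of the number of times p can be iterated on x is definable and
-- differs at x and p(x).  As each standard accuracy is exceeded by m(x) for all but
-- finitely many x, in M the accuracy m(a) is infinite, and then a and b = p(a)
-- satisfy the same infinitary formulas of rank about n.
--
-- Classical reasoning is available constructively for the formulas involved, because a
-- nonstandard model of true arithmetic decides arithmetical truth.
module Submission where

open import Defs
open import Data.Empty using (⊥-elim)
open import Data.Fin using (Fin; zero; suc; toℕ; fromℕ<; funToFin; finToFun; splitAt; _↑ˡ_; _↑ʳ_)
import Data.Fin.Properties as Finₚ
open import Data.Nat using (ℕ; zero; suc; _+_; _*_; _∸_; _≤_; _<_; z≤n; s≤s; z<s; _⊔_; _^_; _!; _%_; _/_; ⌊_/2⌋)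
open import Data.Nat.Coprimality as Coprime using (Coprime; coprime-divisor; coprime-Bézout)
open import Data.Nat.Divisibility
open import Data.Nat.DivMod using (m≡m%n+[m/n]*n; m%n<n; [m+kn]%n≡m%n; m<n⇒m%n≡m)
open import Data.Nat.GCD using (module Bézout)
import Data.Nat.Properties as ℕₚ
open import Data.Nat.Solver using (module +-*-Solver)
open import Data.Product using (Σ; Σ-syntax; ∃; ∃-syntax; _×_; _,_; proj₁; proj₂; swap; uncurry)
open import Data.Product.Function.NonDependent.Propositional using (_×-⇔_)
open import Data.Sum using (_⊎_; inj₁; inj₂; [_,_]′)
open import Data.Sum.Function.Propositional using (_⊎-⇔_)
open import Data.Vec using (Vec; []; _∷_; lookup)
open import Function using (_∘_; id; _⇔_; mk⇔; module Equivalence)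
open import Function.Properties.Equivalence using () renaming (refl to ⇔-refl; sym to ⇔-sym; trans to ⇔-trans)
open import Function.Related.TypeIsomorphisms using (→-cong-⇔)
open import Relation.Binary.Definitions using (tri<; tri≈; tri>)
open import Relation.Binary.PropositionalEquality
open import Relation.Nullary using (¬_; Dec; yes; no; contradiction)
open import Relation.Nullary.Decidable using (map; map′; ¬?; _×-dec_; _⊎-dec_; _→-dec_; decidable-stable)
open Equivalence using (to; from)

-- Substitution and automorphism invariance

≡⇒⇔ : {A B : Set} → A ≡ B → A ⇔ B
≡⇒⇔ refl = ⇔-refl

∀-⇔ : {A : Set} {B C : A → Set} → (∀ a → B a ⇔ C a) → (∀ a → B a) ⇔ (∀ a → C a)
∀-⇔ p = mk⇔ (λ f a → to (p a) (f a)) (λ f a → from (p a) (f a))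

∃-⇔ : {A : Set} {B C : A → Set} → (∀ a → B a ⇔ C a) → Σ A B ⇔ Σ A C
∃-⇔ p = mk⇔ (λ (a , b) → a , to (p a) b) (λ (a , b) → a , from (p a) b)

subT : ∀ {j k} → (Fin j → Term k) → Term j → Term k
subT σ (var i)  = σ i
subT σ `0       = `0
subT σ `1       = `1
subT σ (s `+ t) = subT σ s `+ subT σ t
subT σ (s `* t) = subT σ s `* subT σ t

lift : ∀ {j k} → (Fin j → Term k) → Fin (suc j) → Term (suc k)
lift σ zero    = var zero
lift σ (suc i) = subT (var ∘ suc) (σ i)

sub : ∀ {j k} → (Fin j → Term k) → FO j → FO k
sub σ (s `≈ t) = subT σ s `≈ subT σ t
sub σ (s `< t) = subT σ s `< subT σ t
sub σ `⊥       = `⊥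
sub σ (`¬ φ)   = `¬ sub σ φ
sub σ (φ `∧ ψ) = sub σ φ `∧ sub σ ψ
sub σ (φ `∨ ψ) = sub σ φ `∨ sub σ ψ
sub σ (φ `⇒ ψ) = sub σ φ `⇒ sub σ ψ
sub σ (`∃ φ)   = `∃ sub (lift σ) φ
sub σ (`∀ φ)   = `∀ sub (lift σ) φ

module _ (S : Structure) where

  evalT-subT : ∀ {j k} {ρ : Env S k} {ρ′ : Env S j} (σ : Fin j → Term k) →
               (∀ i → ρ′ i ≡ evalT S ρ (σ i)) → ∀ t → evalT S ρ′ t ≡ evalT S ρ (subT σ t)
  evalT-subT σ p (var i)  = p i
  evalT-subT σ p `0       = refl
  evalT-subT σ p `1       = refl
  evalT-subT σ p (s `+ t) = cong₂ (_+ᴹ_ S) (evalT-subT σ p s) (evalT-subT σ p t)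
  evalT-subT σ p (s `* t) = cong₂ (_*ᴹ_ S) (evalT-subT σ p s) (evalT-subT σ p t)

  lift-ext1 : ∀ {j k} {ρ : Env S k} {ρ′ : Env S j} (σ : Fin j → Term k) →
              (∀ i → ρ′ i ≡ evalT S ρ (σ i)) → ∀ a i → ext1 a ρ′ i ≡ evalT S (ext1 a ρ) (lift σ i)
  lift-ext1 σ p a zero    = refl
  lift-ext1 σ p a (suc i) = trans (p i) (evalT-subT (var ∘ suc) (λ _ → refl) (σ i))

  SatFO-sub : ∀ {j k} {ρ : Env S k} {ρ′ : Env S j} (σ : Fin j → Term k) →
              (∀ i → ρ′ i ≡ evalT S ρ (σ i)) → ∀ φ → SatFO S φ ρ′ ⇔ SatFO S (sub σ φ) ρ
  SatFO-sub σ p (s `≈ t) = ≡⇒⇔ (cong₂ _≡_ (evalT-subT σ p s) (evalT-subT σ p t))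
  SatFO-sub σ p (s `< t) = ≡⇒⇔ (cong₂ (_<ᴹ_ S) (evalT-subT σ p s) (evalT-subT σ p t))
  SatFO-sub σ p `⊥       = ⇔-refl
  SatFO-sub σ p (`¬ φ)   = →-cong-⇔ (SatFO-sub σ p φ) ⇔-refl
  SatFO-sub σ p (φ `∧ ψ) = SatFO-sub σ p φ ×-⇔ SatFO-sub σ p ψ
  SatFO-sub σ p (φ `∨ ψ) = SatFO-sub σ p φ ⊎-⇔ SatFO-sub σ p ψ
  SatFO-sub σ p (φ `⇒ ψ) = →-cong-⇔ (SatFO-sub σ p φ) (SatFO-sub σ p ψ)
  SatFO-sub σ p (`∃ φ)   = ∃-⇔ λ a → SatFO-sub (lift σ) (lift-ext1 σ p a) φ
  SatFO-sub σ p (`∀ φ)   = ∀-⇔ λ a → SatFO-sub (lift σ) (lift-ext1 σ p a) φ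

  module _ (f : Automorphism S) where
    open Automorphism f

    evalT-aut : ∀ {k} {ρ ρ′ : Env S k} → (∀ i → h (ρ i) ≡ ρ′ i) → ∀ t → h (evalT S ρ t) ≡ evalT S ρ′ t
    evalT-aut p (var i)  = p i
    evalT-aut p `0       = pres-0
    evalT-aut p `1       = pres-1
    evalT-aut p (s `+ t) = trans (pres-+ _ _) (cong₂ (_+ᴹ_ S) (evalT-aut p s) (evalT-aut p t))
    evalT-aut p (s `* t) = trans (pres-* _ _) (cong₂ (_*ᴹ_ S) (evalT-aut p s) (evalT-aut p t))

    h-injective : ∀ {a b} → h a ≡ h b → a ≡ b
    h-injective q = trans (sym (left _)) (trans (cong h⁻¹ q) (left _))

    ext1-aut : ∀ {k} {ρ ρ′ : Env S k} → (∀ i → h (ρ i) ≡ ρ′ i) → ∀ a i → h (ext1 a ρ i) ≡ ext1 (h a) ρ′ i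
    ext1-aut p a zero    = refl
    ext1-aut p a (suc i) = p i

    ext1-aut⁻¹ : ∀ {k} {ρ ρ′ : Env S k} → (∀ i → h (ρ i) ≡ ρ′ i) → ∀ b i → h (ext1 (h⁻¹ b) ρ i) ≡ ext1 b ρ′ i
    ext1-aut⁻¹ p b zero    = right b
    ext1-aut⁻¹ p b (suc i) = p i

    SatFO-aut : ∀ {k} {ρ ρ′ : Env S k} → (∀ i → h (ρ i) ≡ ρ′ i) → ∀ φ → SatFO S φ ρ ⇔ SatFO S φ ρ′
    SatFO-aut p (s `≈ t) = ⇔-trans (mk⇔ (cong h) h-injective) (≡⇒⇔ (cong₂ _≡_ (evalT-aut p s) (evalT-aut p t)))
    SatFO-aut p (s `< t) = ⇔-trans (pres-< _ _) (≡⇒⇔ (cong₂ (_<ᴹ_ S) (evalT-aut p s) (evalT-aut p t)))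
    SatFO-aut p `⊥       = ⇔-refl
    SatFO-aut p (`¬ φ)   = →-cong-⇔ (SatFO-aut p φ) ⇔-refl
    SatFO-aut p (φ `∧ ψ) = SatFO-aut p φ ×-⇔ SatFO-aut p ψ
    SatFO-aut p (φ `∨ ψ) = SatFO-aut p φ ⊎-⇔ SatFO-aut p ψ
    SatFO-aut p (φ `⇒ ψ) = →-cong-⇔ (SatFO-aut p φ) (SatFO-aut p ψ)
    SatFO-aut p (`∃ φ)   = mk⇔ (λ (a , s) → h a , to (SatFO-aut (ext1-aut p a) φ) s)
                               (λ (b , s) → h⁻¹ b , from (SatFO-aut (ext1-aut⁻¹ p b) φ) s)
    SatFO-aut p (`∀ φ)   = mk⇔ (λ s b → to (SatFO-aut (ext1-aut⁻¹ p b) φ) (s (h⁻¹ b)))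
                               (λ s a → from (SatFO-aut (ext1-aut p a) φ) (s (h a)))

  idAut : Automorphism S
  idAut = record
    { h = id ; h⁻¹ = id ; left = λ _ → refl ; right = λ _ → refl ; pres-0 = refl ; pres-1 = refl
    ; pres-+ = λ _ _ → refl ; pres-* = λ _ _ → refl ; pres-< = λ _ _ → ⇔-refl }

  -- The identity automorphism carries one environment to the other, so function extensionality is
  -- not called on.
  SatFO-cong : ∀ {k} {ρ ρ′ : Env S k} → (∀ i → ρ i ≡ ρ′ i) → ∀ φ → SatFO S φ ρ ⇔ SatFO S φ ρ′
  SatFO-cong = SatFO-aut idAut

-- First-order formulas bundled with a reading of their semantics

record Fm (k : ℕ) : Set₁ where
  constructor fm
  field
    form : FO k
    sem  : (S : Structure) → Env S k → Set
    ok   : ∀ S ρ → SatFO S form ρ ⇔ sem S ρ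

open Fm

infix  7 _≐_ _≺_
infixr 6 _∧F_
infixr 5 _⇒F_
infix  5 _⇔F_
infix  8 _⟨_⟩
infix  6 ¬F_
infix  4 ∃F_ ∀F_

_≐_ _≺_ : ∀ {k} → Term k → Term k → Fm k
s ≐ t = fm (s `≈ t) (λ S ρ → evalT S ρ s ≡ evalT S ρ t) (λ _ _ → ⇔-refl)
s ≺ t = fm (s `< t) (λ S ρ → _<ᴹ_ S (evalT S ρ s) (evalT S ρ t)) (λ _ _ → ⇔-refl)

¬F_ : ∀ {k} → Fm k → Fm k
¬F φ = fm (`¬ form φ) (λ S ρ → ¬ sem φ S ρ) (λ S ρ → →-cong-⇔ (ok φ S ρ) ⇔-refl)

_∧F_ _⇒F_ _⇔F_ : ∀ {k} → Fm k → Fm k → Fm k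
φ ∧F ψ = fm (form φ `∧ form ψ) (λ S ρ → sem φ S ρ × sem ψ S ρ) (λ S ρ → ok φ S ρ ×-⇔ ok ψ S ρ)
φ ⇒F ψ = fm (form φ `⇒ form ψ) (λ S ρ → sem φ S ρ → sem ψ S ρ) (λ S ρ → →-cong-⇔ (ok φ S ρ) (ok ψ S ρ))
φ ⇔F ψ = (φ ⇒F ψ) ∧F (ψ ⇒F φ)

∃F_ ∀F_ : ∀ {k} → Fm (suc k) → Fm k
∃F φ = fm (`∃ form φ) (λ S ρ → Σ[ a ∈ Carrier S ] sem φ S (ext1 a ρ)) (λ S ρ → ∃-⇔ λ a → ok φ S (ext1 a ρ))
∀F φ = fm (`∀ form φ) (λ S ρ → (a : Carrier S) → sem φ S (ext1 a ρ)) (λ S ρ → ∀-⇔ λ a → ok φ S (ext1 a ρ))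

⋀F : ∀ {k n} → (Fin n → Fm k) → Fm k
⋀F φ = fm (⋀ (form ∘ φ)) (λ S ρ → ∀ t → sem (φ t) S ρ) (λ S ρ → ok-⋀ S (λ t → ok (φ t) S ρ))
  where
  ⋀ : ∀ {k n} → (Fin n → FO k) → FO k
  ⋀ {n = zero}  φ = `0 `≈ `0
  ⋀ {n = suc n} φ = φ zero `∧ ⋀ (φ ∘ suc)

  ok-⋀ : ∀ S {k n} {φ : Fin n → FO k} {ρ} {P : Fin n → Set} →
         (∀ t → SatFO S (φ t) ρ ⇔ P t) → SatFO S (⋀ φ) ρ ⇔ (∀ t → P t)
  ok-⋀ S {n = zero}  p = mk⇔ (λ _ ()) (λ _ → refl)
  ok-⋀ S {n = suc n} p = mk⇔
    (λ (s , r) → λ { zero → to (p zero) s ; (suc t) → to (ok-⋀ S (p ∘ suc)) r t })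
    (λ f → from (p zero) (f zero) , from (ok-⋀ S (p ∘ suc)) (f ∘ suc))

-- The reading evaluates the terms into a new environment instead of rewriting syntax, so nested
-- uses compute to the intended relation between elements, in ℕ as in M.
_⟨_⟩ : ∀ {j k} → Fm j → Vec (Term k) j → Fm k
φ ⟨ ts ⟩ = fm (sub (lookup ts) (form φ)) (λ S ρ → sem φ S (λ i → evalT S ρ (lookup ts i)))
  (λ S ρ → ⇔-trans (⇔-sym (SatFO-sub S (lookup ts) (λ _ → refl) (form φ))) (ok φ S _))

⟦_⟧ : ∀ {k} → Fm k → (S : Structure) → Vec (Carrier S) k → Set
⟦ φ ⟧ S as = sem φ S (lookup as)

x0 : ∀ {k} → Term (1 + k)
x0 = var zero
x1 : ∀ {k} → Term (2 + k)
x1 = var (suc zero)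
x2 : ∀ {k} → Term (3 + k)
x2 = var (suc (suc zero))
x3 : ∀ {k} → Term (4 + k)
x3 = var (suc (suc (suc zero)))
x4 : ∀ {k} → Term (5 + k)
x4 = var (suc (suc (suc (suc zero))))
x5 : ∀ {k} → Term (6 + k)
x5 = var (suc (suc (suc (suc (suc zero)))))
x6 : ∀ {k} → Term (7 + k)
x6 = var (suc (suc (suc (suc (suc (suc zero))))))
x7 : ∀ {k} → Term (8 + k)
x7 = var (suc (suc (suc (suc (suc (suc (suc zero)))))))
x8 : ∀ {k} → Term (9 + k)
x8 = var (suc (suc (suc (suc (suc (suc (suc (suc zero))))))))

-- Gödel's β function

-- The pair a, b codes the sequence i ↦ a mod (1 + (1 + i) b).

Entry : Fm 4
Entry = x3 ≺ modulus x1 x2 ∧F (∃F x1 ≐ x4 `+ (x0 `* modulus x2 x3))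
  where
  modulus : ∀ {k} → Term k → Term k → Term k
  modulus b i = `1 `+ ((`1 `+ i) `* b)

coprime-* : ∀ {c m n} → Coprime c m → Coprime c n → Coprime c (m * n)
coprime-* {m = m} p q {k} (k∣c , k∣mn) =
  q (k∣c , coprime-divisor {n = m} (λ (l∣k , l∣m) → p (∣-trans l∣k k∣c , l∣m)) k∣mn)

inverse : ∀ {p e} → Coprime p (2 + e) → ∃[ x ] ∃[ y ] x * p ≡ 1 + y * (2 + e)
inverse {p} {e} c with coprime-Bézout c
... | Bézout.Identity.+- x y eq = x , y , sym eq
-- Here x p is -1 modulo 2 + e; multiplying by 1 + e, which is -1 as well, turns it into 1.
... | Bézout.Identity.-+ x (suc y) eq =
  x * suc e , e + y * suc e , ℕₚ.+-cancelʳ-≡ (suc e) _ _ (begin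
    x * suc e * p + suc e                     ≡⟨ solve 3 (λ x p e → x :* e :* p :+ e := (con 1 :+ x :* p) :* e) refl x p (suc e) ⟩
    (1 + x * p) * suc e                       ≡⟨ cong (_* suc e) eq ⟩
    suc y * (2 + e) * suc e                   ≡⟨ solve 2 (λ y e → (con 1 :+ y) :* (con 2 :+ e) :* (con 1 :+ e)
                                                   := con 1 :+ (e :+ y :* (con 1 :+ e)) :* (con 2 :+ e) :+ (con 1 :+ e)) refl y e ⟩
    1 + (e + y * suc e) * (2 + e) + suc e     ∎)
  where
  open ≡-Reasoning
  open +-*-Solver

crt-step : ∀ a v {p e} → Coprime p (2 + e) → ∃[ t ] ∃[ q ] a + p * t ≡ v + q * (2 + e)
crt-step a v {p} {e} c with inverse c
... | x , y , eq = x * s , a + y * s , (begin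
  a + p * (x * s)                ≡⟨ solve 4 (λ a p x s → a :+ p :* (x :* s) := a :+ x :* p :* s) refl a p x s ⟩
  a + x * p * s                  ≡⟨ cong (λ z → a + z * s) eq ⟩
  a + (1 + y * (2 + e)) * s      ≡⟨ solve 4 (λ a v y e → let s = v :+ a :* (con 1 :+ e) in
                                     a :+ (con 1 :+ y :* (con 2 :+ e)) :* s := v :+ (a :+ y :* s) :* (con 2 :+ e)) refl a v y e ⟩
  v + (a + y * s) * (2 + e)      ∎)
  where
  open ≡-Reasoning
  open +-*-Solver
  -- This is v - a modulo 2 + e, with 1 + e playing the part of -1.
  s = v + a * suc e

module _ (d g : ℕ → ℕ) where

  ∏ : ℕ → ℕ
  ∏ zero    = 1
  ∏ (suc n) = d n * ∏ n

  d∣∏ : ∀ {i n} → i < n → d i ∣ ∏ n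
  d∣∏ {i} {suc n} i<n with ℕₚ.m<1+n⇒m<n∨m≡n i<n
  ... | inj₁ i<n′ = ∣n⇒∣m*n (d n) (d∣∏ i<n′)
  ... | inj₂ refl = m∣m*n (∏ n)

  coprime-∏ : ∀ {c} n → (∀ {i} → i < n → Coprime c (d i)) → Coprime c (∏ n)
  coprime-∏ zero    p = λ (_ , k∣1) → ∣1⇒≡1 k∣1
  coprime-∏ (suc n) p = coprime-* {m = d n} (p ℕₚ.≤-refl) (coprime-∏ n (λ i<n → p (ℕₚ.m≤n⇒m≤1+n i<n)))

  -- Induction on n: adding a multiple of the product of the earlier moduli keeps the earlier
  -- residues, and `crt-step` picks the multiple that makes the new residue right.
  chinese-remainder : (∀ i → ∃[ e ] d i ≡ 2 + e) → ∀ n →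
                      (∀ {i j} → i < j → j < n → Coprime (d i) (d j)) →
                      ∃[ a ] (∀ i → i < n → ∃[ q ] a ≡ g i + q * d i)
  chinese-remainder d≥2 zero    c = 0 , λ _ ()
  chinese-remainder d≥2 (suc n) c = a + ∏ n * t , sol′
    where
    ih : ∃[ a ] (∀ i → i < n → ∃[ q ] a ≡ g i + q * d i)
    ih = chinese-remainder d≥2 n (λ i<j j<n → c i<j (ℕₚ.m≤n⇒m≤1+n j<n))
    a e : ℕ
    a = proj₁ ih
    e = proj₁ (d≥2 n)
    dn≡ : d n ≡ 2 + e
    dn≡ = proj₂ (d≥2 n)
    step : ∃[ t ] ∃[ q ] a + ∏ n * t ≡ g n + q * (2 + e)
    step = crt-step a (g n) (subst (Coprime (∏ n)) dn≡ (Coprime.sym (coprime-∏ n λ i<n → Coprime.sym (c i<n ℕₚ.≤-refl))))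
    t q : ℕ
    t = proj₁ step
    q = proj₁ (proj₂ step)
    eq : a + ∏ n * t ≡ g n + q * (2 + e)
    eq = proj₂ (proj₂ step)
    open ≡-Reasoning
    open +-*-Solver
    sol′ : ∀ i → i < suc n → ∃[ q ] a + ∏ n * t ≡ g i + q * d i
    sol′ i i<1+n with ℕₚ.m<1+n⇒m<n∨m≡n i<1+n
    ... | inj₂ refl = q , trans eq (cong (λ z → g n + q * z) (sym dn≡))
    ... | inj₁ i<n with proj₂ ih i i<n | d∣∏ i<n
    ...   | q′ , a≡ | divides r ∏≡ = q′ + r * t , (begin
      a + ∏ n * t                    ≡⟨ cong₂ (λ y z → y + z * t) a≡ ∏≡ ⟩
      g i + q′ * d i + r * d i * t   ≡⟨ solve 5 (λ g q d r t → g :+ q :* d :+ r :* d :* t := g :+ (q :+ r :* t) :* d)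
                                          refl (g i) q′ (d i) r t ⟩
      g i + (q′ + r * t) * d i       ∎)

-- A common divisor is coprime to b, since it divides 1 + (1 + i) b. It divides the difference b (j
-- - i) of the two moduli, hence j - i, hence b, and so it is 1.
β-coprime : ∀ {b i j} → i < j → (∀ {δ} → 0 < δ → δ ≤ j → δ ∣ b) → Coprime (1 + (1 + i) * b) (1 + (1 + j) * b)
β-coprime {b} {i} {j} i<j δ∣b {k} (k∣di , k∣dj) = ∣1⇒≡1 (∣b⇒∣1 ∣-refl k∣b)
  where
  open ≡-Reasoning
  open +-*-Solver
  δ = j ∸ i
  ∣b⇒∣1 : ∀ {l} → l ∣ k → l ∣ b → l ∣ 1
  ∣b⇒∣1 {l} l∣k l∣b = ∣m+n∣m⇒∣n (subst (l ∣_) (ℕₚ.+-comm 1 _) (∣-trans l∣k k∣di)) (∣n⇒∣m*n (1 + i) l∣b)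
  dj≡ : 1 + (1 + j) * b ≡ (1 + (1 + i) * b) + b * δ
  dj≡ = begin
    1 + (1 + j) * b              ≡⟨ cong (λ z → 1 + (1 + z) * b) (sym (ℕₚ.m+[n∸m]≡n (ℕₚ.<⇒≤ i<j))) ⟩
    1 + (1 + (i + δ)) * b        ≡⟨ solve 3 (λ i δ b → con 1 :+ (con 1 :+ (i :+ δ)) :* b
                                      := (con 1 :+ (con 1 :+ i) :* b) :+ b :* δ) refl i δ b ⟩
    (1 + (1 + i) * b) + b * δ    ∎
  k∣δ : k ∣ δ
  k∣δ = coprime-divisor {n = b} (λ (l∣k , l∣b) → ∣1⇒≡1 (∣b⇒∣1 l∣k l∣b))
          (∣m+n∣m⇒∣n (subst (k ∣_) dj≡ k∣dj) k∣di)
  k∣b : k ∣ b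
  k∣b = ∣-trans k∣δ (δ∣b (ℕₚ.m<n⇒0<n∸m i<j) (ℕₚ.m∸n≤m j i))

∣! : ∀ {δ n} → 0 < δ → δ ≤ n → δ ∣ n !
∣! {suc δ} _ δ≤n = ∣-trans (m∣m*n (δ !)) (m≤n⇒m!∣n! δ≤n)

≤! : ∀ {m n} → m ≤ n → m ≤ n !
≤! {zero}  _ = z≤n
≤! {suc m} {n} m≤n = ∣⇒≤ {{n ℕₚ.!≢0}} (∣! z<s m≤n)

∑ : (ℕ → ℕ) → ℕ → ℕ
∑ g zero    = 0
∑ g (suc n) = g n + ∑ g n

term≤∑ : ∀ g {i n} → i < n → g i ≤ ∑ g n
term≤∑ g {n = suc n} i<n with ℕₚ.m<1+n⇒m<n∨m≡n i<n
... | inj₁ i<n′ = ℕₚ.≤-trans (term≤∑ g i<n′) (ℕₚ.m≤n+m _ (g n))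
... | inj₂ refl = ℕₚ.m≤m+n (g n) _

abstract
  β-lemma : ∀ (g : ℕ → ℕ) n → ∃[ a ] ∃[ b ] (∀ i → i < n → ⟦ Entry ⟧ ℕ-std (a ∷ b ∷ i ∷ g i ∷ []))
  β-lemma g n = proj₁ sol , b , λ i i<n → entry-< i i<n , proj₂ sol i i<n
    where
    bound b : ℕ
    -- The summand n makes every difference of indices divide b; the summand `∑ g n` makes each
    -- modulus exceed the value to be coded.
    bound = n + ∑ g n
    b = bound !
    d : ℕ → ℕ
    d i = 1 + (1 + i) * b
    entry-< : ∀ i → i < n → g i < d i
    entry-< i i<n = s≤s (ℕₚ.≤-trans (≤! (ℕₚ.≤-trans (term≤∑ g i<n) (ℕₚ.m≤n+m _ n))) (ℕₚ.m≤m+n b (i * b)))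
    d≥2 : ∀ i → ∃[ e ] d i ≡ 2 + e
    d≥2 i with b | ℕₚ.1≤n! bound
    ... | suc b′ | _ = _ , refl
    sol : ∃[ a ] (∀ i → i < n → ∃[ q ] a ≡ g i + q * d i)
    sol = chinese-remainder d g d≥2 n λ i<j j<n →
      β-coprime i<j λ 0<δ δ≤j → ∣! 0<δ (ℕₚ.≤-trans δ≤j (ℕₚ.≤-trans (ℕₚ.<⇒≤ j<n) (ℕₚ.m≤m+n n _)))

entry : ℕ → ℕ → ℕ → ℕ
entry a b i = a % suc ((1 + i) * b)

Entry-entry : ∀ a b i → ⟦ Entry ⟧ ℕ-std (a ∷ b ∷ i ∷ entry a b i ∷ [])
Entry-entry a b i = m%n<n a (suc ((1 + i) * b)) , a / suc ((1 + i) * b) , m≡m%n+[m/n]*n a (suc ((1 + i) * b))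

Entry⇒entry : ∀ {a b i v} → ⟦ Entry ⟧ ℕ-std (a ∷ b ∷ i ∷ v ∷ []) → v ≡ entry a b i
Entry⇒entry {a} {b} {i} {v} (v<d , q , eq) = sym (trans (cong (_% suc ((1 + i) * b)) eq)
  (trans ([m+kn]%n≡m%n v q (suc ((1 + i) * b))) (m<n⇒m%n≡m v<d)))

Entry-unique : ∀ {a b i v w} → ⟦ Entry ⟧ ℕ-std (a ∷ b ∷ i ∷ v ∷ []) → ⟦ Entry ⟧ ℕ-std (a ∷ b ∷ i ∷ w ∷ []) → v ≡ w
Entry-unique {a} {b} {i} p q = trans (Entry⇒entry {a} {b} {i} p) (sym (Entry⇒entry {a} {b} {i} q))

-- Transfer between ℕ and a model of true arithmetic

module Transfer (M : Structure) (ta : ModelOfTA M) where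

  ι : ℕ → Carrier M
  ι n = evalT M (emptyEnv M) (numeral n)

  evalT-numeral : ∀ n → n ≡ evalT ℕ-std (emptyEnv ℕ-std) (numeral n)
  evalT-numeral zero    = refl
  evalT-numeral (suc n) = trans (ℕₚ.+-comm 1 n) (cong (_+ 1) (evalT-numeral n))

  -- Numerals put in for the parameters turn φ into a sentence, to which `ta` applies.
  transferFO : ∀ {k} (φ : FO k) (ρ : Env ℕ-std k) → SatFO ℕ-std φ ρ ⇔ SatFO M φ (ι ∘ ρ)
  transferFO φ ρ = ⇔-trans (SatFO-sub ℕ-std (numeral ∘ ρ) (evalT-numeral ∘ ρ) φ)
    (⇔-trans (ta (sub (numeral ∘ ρ) φ)) (⇔-sym (SatFO-sub M (numeral ∘ ρ) (λ _ → refl) φ)))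

  transferAt : ∀ {k} (φ : Fm k) (ρ : Env ℕ-std k) → sem φ ℕ-std ρ ⇔ sem φ M (ι ∘ ρ)
  transferAt φ ρ = ⇔-trans (⇔-sym (ok φ ℕ-std ρ)) (⇔-trans (transferFO (form φ) ρ) (ok φ M (ι ∘ ρ)))

  transfer : (φ : Fm 0) → sem φ ℕ-std (emptyEnv ℕ-std) → sem φ M (emptyEnv M)
  transfer φ s = to (ok φ M _) (to (ta (form φ)) (from (ok φ ℕ-std _) s))

  ι-+ : ∀ m n → ι (m + n) ≡ _+ᴹ_ M (ι m) (ι n)
  ι-+ m n = to (transferFO (x0 `≈ (x1 `+ x2)) (ext1 (m + n) (ext1 m (ext1 n (emptyEnv ℕ-std))))) refl

  Infinite : Carrier M → Set
  Infinite a = ∀ n → _<ᴹ_ M (ι n) a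

  -- Induction on n: it is true in ℕ, hence in M, that a number above u is u + 1 or above u + 1, and
  -- a is no numeral.
  nonstandard⇒infinite : ∀ {a} → (∀ n → ¬ ι n ≡ a) → Infinite a
  nonstandard⇒infinite {a} a≢ zero with to (ta (`∀ ((x0 `≈ `0) `∨ (`0 `< x0)))) (λ { zero → inj₁ refl ; (suc _) → inj₂ (s≤s z≤n) }) a
  ... | inj₁ a≡0 = ⊥-elim (a≢ 0 (sym a≡0))
  ... | inj₂ 0<a = 0<a
  nonstandard⇒infinite {a} a≢ (suc n)
    with to (ta (`∀ `∀ ((x0 `< x1) `⇒ ((x1 `≈ (x0 `+ `1)) `∨ ((x0 `+ `1) `< x1))))) step a (ι n) (nonstandard⇒infinite a≢ n)
    where
    step : ∀ x u → u < x → x ≡ u + 1 ⊎ u + 1 < x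
    step x u u<x rewrite ℕₚ.+-comm u 1 with ℕₚ.m≤n⇒m<n∨m≡n u<x
    ... | inj₁ p = inj₂ p
    ... | inj₂ p = inj₁ (sym p)
  ... | inj₁ p = ⊥-elim (a≢ (suc n) (sym p))
  ... | inj₂ p = p

-- An infinite element decides arithmetical truth: ∃ u φ(u) holds in ℕ iff
-- ∃ u < ∞ φ(u) holds in M, and bounded existentials are decidable in ℕ, hence in M.

module Decide (M : Structure) (ta : ModelOfTA M) (∞ : Carrier M) (inf : Transfer.Infinite M ta ∞) where
  open Transfer M ta

  skip1 : ∀ {k} → Fin (suc k) → Term (2 + k)
  skip1 zero    = x0
  skip1 (suc i) = var (suc (suc i))

  skip1-ext1 : ∀ S {k} (u m : Carrier S) (ρ : Env S k) i → ext1 u ρ i ≡ evalT S (ext1 u (ext1 m ρ)) (skip1 i)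
  skip1-ext1 S u m ρ zero    = refl
  skip1-ext1 S u m ρ (suc i) = refl

  decide-∃ : ∀ {k} (φ : FO (suc k)) → (∀ ρ → Dec (SatFO ℕ-std φ ρ)) → ∀ ρ → Dec (SatFO ℕ-std (`∃ φ) ρ)
  decide-∃ {k} φ φ? ρ with to (transferFO (`∀ (below `∨ (`¬ below))) ρ) below? ∞
    where
    below : FO (suc k)
    below = `∃ ((x0 `< x1) `∧ sub skip1 φ)

    below? : ∀ m → SatFO ℕ-std (below `∨ (`¬ below)) (ext1 m ρ)
    below? m with ℕₚ.anyUpTo? (λ u → map (SatFO-sub ℕ-std skip1 (skip1-ext1 ℕ-std u m ρ) φ) (φ? (ext1 u ρ))) m
    ... | yes p = inj₁ p
    ... | no ¬p = inj₂ ¬p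
  -- The witness u may be nonstandard, so it is the existential statement, not u, that is brought
  -- back to ℕ. In the other case a standard witness would lie below ∞.
  ... | inj₁ (u , _ , s) =
    yes (from (transferFO (`∃ φ) ρ) (u , from (SatFO-sub M skip1 (skip1-ext1 M u ∞ _) φ) s))
  ... | inj₂ ¬s = no λ (u , s) → ¬s (ι u , inf u ,
    to (SatFO-sub M skip1 (skip1-ext1 M (ι u) ∞ _) φ)
       (to (SatFO-cong M (λ { zero → refl ; (suc _) → refl }) φ) (to (transferFO φ (ext1 u ρ)) s)))

  decideFO : ∀ {k} (φ : FO k) (ρ : Env ℕ-std k) → Dec (SatFO ℕ-std φ ρ)
  decideFO (s `≈ t) ρ = evalT ℕ-std ρ s ℕₚ.≟ evalT ℕ-std ρ t
  decideFO (s `< t) ρ = evalT ℕ-std ρ s ℕₚ.<? evalT ℕ-std ρ t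
  decideFO `⊥       ρ = no id
  decideFO (`¬ φ)   ρ = ¬? (decideFO φ ρ)
  decideFO (φ `∧ ψ) ρ = decideFO φ ρ ×-dec decideFO ψ ρ
  decideFO (φ `∨ ψ) ρ = decideFO φ ρ ⊎-dec decideFO ψ ρ
  decideFO (φ `⇒ ψ) ρ = decideFO φ ρ →-dec decideFO ψ ρ
  decideFO (`∃ φ)   ρ = decide-∃ φ (decideFO φ) ρ
  decideFO (`∀ φ)   ρ = map′ (λ ¬s a → decidable-stable (decideFO φ (ext1 a ρ)) λ ¬t → ¬s (a , ¬t))
                             (λ s (a , ¬t) → ¬t (s a)) (¬? (decide-∃ (`¬ φ) (λ ρ′ → ¬? (decideFO φ ρ′)) ρ))

  decide : ∀ {k} (φ : Fm k) as → Dec (⟦ φ ⟧ ℕ-std as)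
  decide φ as = map (ok φ ℕ-std _) (decideFO (form φ) _)

-- Back-and-forth relations

-- Ext m a b c d: the sequence coded by c, d carries the first m entries of the one
-- coded by a, b at its even positions, which leaves the odd ones free for new data.

Ext : Fm 5
Ext = ∀F x0 ≺ x1 ⇒F (∃F Entry ⟨ x3 ∷ x4 ∷ x1 ∷ x0 ∷ [] ⟩ ∧F Entry ⟨ x5 ∷ x6 ∷ (x1 `+ x1) ∷ x0 ∷ [] ⟩)

pattern is≈ = zero
pattern is< = suc zero
pattern is0 = suc (suc zero)
pattern is1 = suc (suc (suc zero))
pattern is+ = suc (suc (suc (suc zero)))
pattern is* = suc (suc (suc (suc (suc zero))))

-- Unnested atoms suffice: compound terms are evaluated later through stored values of their
-- subterms. With six atoms there are finitely many patterns on m entries.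
AtomRel : (S : Structure) → Fin 6 → (u v w : Carrier S) → Set
AtomRel S is≈ u v w = u ≡ v
AtomRel S is< u v w = _<ᴹ_ S u v
AtomRel S is0 u v w = u ≡ zeroᴹ S
AtomRel S is1 u v w = u ≡ oneᴹ S
AtomRel S is+ u v w = _+ᴹ_ S u v ≡ w
AtomRel S is* u v w = _*ᴹ_ S u v ≡ w

Atom : Fin 6 → Fm 3
Atom t = fm (form (atom t)) (λ S ρ → AtomRel S t (ρ zero) (ρ (suc zero)) (ρ (suc (suc zero)))) (atom-ok t)
  where
  atom : Fin 6 → Fm 3
  atom is≈ = x0 ≐ x1
  atom is< = x0 ≺ x1
  atom is0 = x0 ≐ `0
  atom is1 = x0 ≐ `1
  atom is+ = x0 `+ x1 ≐ x2
  atom is* = x0 `* x1 ≐ x2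

  atom-ok : ∀ t S ρ → SatFO S (form (atom t)) ρ ⇔ AtomRel S t (ρ zero) (ρ (suc zero)) (ρ (suc (suc zero)))
  atom-ok is≈ S ρ = ⇔-refl
  atom-ok is< S ρ = ⇔-refl
  atom-ok is0 S ρ = ⇔-refl
  atom-ok is1 S ρ = ⇔-refl
  atom-ok is+ S ρ = ⇔-refl
  atom-ok is* S ρ = ⇔-refl

Holds : Fin 6 → Fm 5
Holds t = ∃F ∃F ∃F Entry ⟨ x3 ∷ x4 ∷ x5 ∷ x2 ∷ [] ⟩ ∧F Entry ⟨ x3 ∷ x4 ∷ x6 ∷ x1 ∷ [] ⟩ ∧F
                   Entry ⟨ x3 ∷ x4 ∷ x7 ∷ x0 ∷ [] ⟩ ∧F Atom t ⟨ x2 ∷ x1 ∷ x0 ∷ [] ⟩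

SameAtoms : Fm 5
SameAtoms = ∀F ∀F ∀F x2 ≺ x3 ⇒F x1 ≺ x3 ⇒F x0 ≺ x3 ⇒F ⋀F λ t →
  Holds t ⟨ x4 ∷ x5 ∷ x2 ∷ x1 ∷ x0 ∷ [] ⟩ ⇔F Holds t ⟨ x6 ∷ x7 ∷ x2 ∷ x1 ∷ x0 ∷ [] ⟩

-- The n-round back-and-forth relation between coded sequences, with accuracy m.  A move
-- adds a whole coded sequence, so it can stand for a block of quantifiers of any length.

BFRel : (S : Structure) → ℕ → (m a b c d : Carrier S) → Set
BFRel S zero    m a b c d = ⟦ SameAtoms ⟧ S (m ∷ a ∷ b ∷ c ∷ d ∷ [])
BFRel S (suc n) m a b c d =
  (∀ z z′ → ⟦ Ext ⟧ S (m ∷ a ∷ b ∷ z ∷ z′ ∷ []) →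
    Σ[ w ∈ _ ] Σ[ w′ ∈ _ ] ⟦ Ext ⟧ S (m ∷ c ∷ d ∷ w ∷ w′ ∷ []) × BFRel S n m z z′ w w′) ×
  (∀ w w′ → ⟦ Ext ⟧ S (m ∷ c ∷ d ∷ w ∷ w′ ∷ []) →
    Σ[ z ∈ _ ] Σ[ z′ ∈ _ ] ⟦ Ext ⟧ S (m ∷ a ∷ b ∷ z ∷ z′ ∷ []) × BFRel S n m z z′ w w′)

-- The number n of rounds is fixed outside the formula, whereas the accuracy is a variable and so
-- can take a nonstandard value in M.
BF-formula : ∀ n → Σ[ φ ∈ FO 5 ] (∀ S ρ → SatFO S φ ρ ⇔
  BFRel S n (ρ zero) (ρ (suc zero)) (ρ (suc (suc zero))) (ρ (suc (suc (suc zero)))) (ρ (suc (suc (suc (suc zero))))))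
BF-formula zero    = form SameAtoms , ok SameAtoms
BF-formula (suc n) = form round , ok round
  where
  previous : Fm 5
  previous = fm (proj₁ (BF-formula n)) _ (proj₂ (BF-formula n))

  round : Fm 5
  round =
    (∀F ∀F Ext ⟨ x2 ∷ x3 ∷ x4 ∷ x1 ∷ x0 ∷ [] ⟩ ⇒F
      (∃F ∃F Ext ⟨ x4 ∷ x7 ∷ x8 ∷ x1 ∷ x0 ∷ [] ⟩ ∧F previous ⟨ x4 ∷ x3 ∷ x2 ∷ x1 ∷ x0 ∷ [] ⟩)) ∧F
    (∀F ∀F Ext ⟨ x2 ∷ x5 ∷ x6 ∷ x1 ∷ x0 ∷ [] ⟩ ⇒F
      (∃F ∃F Ext ⟨ x4 ∷ x5 ∷ x6 ∷ x1 ∷ x0 ∷ [] ⟩ ∧F previous ⟨ x4 ∷ x1 ∷ x0 ∷ x3 ∷ x2 ∷ [] ⟩))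

BF : ℕ → Fm 5
BF n = fm (proj₁ (BF-formula n)) _ (proj₂ (BF-formula n))

BF-sym : ∀ S n {m a b c d} → BFRel S n m a b c d → BFRel S n m c d a b
BF-sym S zero    e i j l i< j< l< t = swap (e i j l i< j< l< t)
BF-sym S (suc n) (forth , back) =
  (λ z z′ x → let w , w′ , y , e = back z z′ x in w , w′ , y , BF-sym S n e) ,
  (λ z z′ x → let w , w′ , y , e = forth z z′ x in w , w′ , y , BF-sym S n e)

BF-trans : ∀ S n {m a b c d e f} → BFRel S n m a b c d → BFRel S n m c d e f → BFRel S n m a b e f
BF-trans S zero p q i j l i< j< l< t =
  proj₁ (q i j l i< j< l< t) ∘ proj₁ (p i j l i< j< l< t) , proj₂ (p i j l i< j< l< t) ∘ proj₂ (q i j l i< j< l< t)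
BF-trans S (suc n) (forth , back) (forth′ , back′) =
  (λ z z′ x → let w , w′ , y , e = forth z z′ x ; v , v′ , y′ , e′ = forth′ w w′ y in v , v′ , y′ , BF-trans S n e e′) ,
  (λ z z′ x → let w , w′ , y , e = back′ z z′ x ; v , v′ , y′ , e′ = back w w′ y in v , v′ , y′ , BF-trans S n e′ e)

-- Finite index of the back-and-forth relations on ℕ

bit : {A : Set} → Dec A → Fin 2
bit (yes _) = zero
bit (no _)  = suc zero

bit-≡ : {A B : Set} (p : Dec A) (q : Dec B) → bit p ≡ bit q → (A → B) × (B → A)
bit-≡ (yes a) (yes b) _ = (λ _ → b) , (λ _ → a)
bit-≡ (no ¬a) (no ¬b) _ = (⊥-elim ∘ ¬a) , (⊥-elim ∘ ¬b)

funToFin-injective : ∀ {m n} {f g : Fin m → Fin n} → funToFin f ≡ funToFin g → ∀ i → f i ≡ g i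
funToFin-injective {f = f} {g} eq i =
  trans (sym (Finₚ.finToFun-funToFin f i)) (trans (cong (λ x → finToFun x i) eq) (Finₚ.finToFun-funToFin g i))

module _ {X : Set} (size : X → ℕ) (_~_ : X → X → Set) where

  Near : ℕ → X → Set
  Near f x = ∃[ y ] size y < f × x ~ y

  -- Points are chosen in turn, each related to none of the earlier ones; n + 1 of them must repeat
  -- a signature.
  no-escape : ∀ {n} (sig : X → Fin n) → (∀ {x y} → sig x ≡ sig y → x ~ y) → ¬ (∀ f → ∃[ x ] ¬ Near f x)
  no-escape {n} sig sig⇒~ escape = collide (Finₚ.pigeonhole (ℕₚ.n<1+n n) (sig ∘ pt ∘ toℕ))
    where
    bound : ℕ → ℕ
    pt    : ℕ → X
    bound zero    = 0
    bound (suc i) = bound i ⊔ suc (size (pt i))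
    pt i = proj₁ (escape (bound i))

    size<bound : ∀ {i j} → i < j → size (pt i) < bound j
    size<bound {i} {suc j} i<j with ℕₚ.m<1+n⇒m<n∨m≡n i<j
    ... | inj₁ i<j′ = ℕₚ.≤-trans (size<bound i<j′) (ℕₚ.m≤m⊔n (bound j) _)
    ... | inj₂ refl = ℕₚ.m≤n⊔m (bound j) _

    collide : ¬ (∃[ i ] ∃[ j ] toℕ i < toℕ j × sig (pt (toℕ i)) ≡ sig (pt (toℕ j)))
    collide (i , j , i<j , eq) = proj₂ (escape (bound (toℕ j))) (_ , size<bound i<j , sig⇒~ (sym eq))

  -- Without a bound every f would be escaped, against `no-escape`. The three decisions do the work
  -- of classical logic here.
  finite-index : (∀ f x → Dec (Near f x)) → (∀ f → Dec (∃[ x ] ¬ Near f x)) → Dec (∃[ f ] ¬ (∃[ x ] ¬ Near f x)) →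
                 ∀ {n} (sig : X → Fin n) → (∀ {x y} → sig x ≡ sig y → x ~ y) → ∃[ f ] (∀ x → Near f x)
  finite-index near? far? (yes (f , ¬far)) sig sig⇒~ =
    f , λ x → decidable-stable (near? f x) λ ¬near → ¬far (x , ¬near)
  finite-index near? far? (no ¬fin) sig sig⇒~ = ⊥-elim
    (no-escape sig sig⇒~ λ f → decidable-stable (far? f) λ ¬far → ¬fin (f , ¬far))

module FiniteIndex (decide : ∀ {k} (φ : Fm k) as → Dec (⟦ φ ⟧ ℕ-std as)) where

  _~[_,_]_ : ℕ × ℕ → ℕ → ℕ → ℕ × ℕ → Set
  (a , b) ~[ n , m ] (c , d) = BFRel ℕ-std n m a b c d

  size : ℕ × ℕ → ℕ
  size (a , b) = a + b

  near : ℕ → Fm 4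
  near n = ∃F ∃F x1 `+ x0 ≺ x2 ∧F BF n ⟨ x3 ∷ x4 ∷ x5 ∷ x1 ∷ x0 ∷ [] ⟩

  far : ℕ → Fm 2
  far n = ∃F ∃F ¬F near n ⟨ x2 ∷ x3 ∷ x1 ∷ x0 ∷ [] ⟩

  FiniteIndex : ℕ → ℕ → Set
  FiniteIndex n m = ∃[ f ] (∀ x → Near size (_~[ n , m ]_) f x)

  BF-finite-index′ : ∀ n m {N} (sig : ℕ × ℕ → Fin N) → (∀ {x y} → sig x ≡ sig y → x ~[ n , m ] y) → FiniteIndex n m
  BF-finite-index′ n m = finite-index size (_~[ n , m ]_)
    (λ f (a , b) → near′ (decide (near n) (f ∷ m ∷ a ∷ b ∷ [])))
    (λ f → far′ (decide (far n) (f ∷ m ∷ [])))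
    (map′ (λ (f , ¬far) → f , ¬far ∘ λ ((a , b) , p) → a , b , λ (c , d , q) → p ((c , d) , q))
          (λ (f , ¬far) → f , ¬far ∘ λ (a , b , p) → (a , b) , λ ((c , d) , q) → p (c , d , q))
          (decide (∃F ¬F far n ⟨ x0 ∷ x1 ∷ [] ⟩) (m ∷ [])))
    where
    near′ : ∀ {P : ℕ → ℕ → Set} → Dec (∃[ a ] ∃[ b ] P a b) → Dec (∃[ x ] uncurry P x)
    near′ = map′ (λ (a , b , p) → (a , b) , p) (λ ((a , b) , p) → a , b , p)
    far′ : ∀ {P : ℕ → ℕ → ℕ → ℕ → Set} → Dec (∃[ a ] ∃[ b ] ¬ (∃[ c ] ∃[ d ] P a b c d)) →
           Dec (∃[ x ] ¬ (∃[ y ] uncurry (uncurry P x) y))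
    far′ = map′ (λ (a , b , p) → (a , b) , λ ((c , d) , q) → p (c , d , q)) (λ ((a , b) , p) → a , b , λ (c , d , q) → p ((c , d) , q))

  -- The set of classes that one move can reach, each class being named by a representative c, d.
  -- This set determines the class for one more round.
  Reach : ℕ → Fm 5
  Reach n = ∃F ∃F Ext ⟨ x2 ∷ x3 ∷ x4 ∷ x1 ∷ x0 ∷ [] ⟩ ∧F BF n ⟨ x2 ∷ x1 ∷ x0 ∷ x5 ∷ x6 ∷ [] ⟩

  ∀Fin⇒∀< : ∀ {n} (P : ℕ → Set) → (∀ (j : Fin n) → P (toℕ j)) → ∀ i → i < n → P i
  ∀Fin⇒∀< P p i i<n = subst P (Finₚ.toℕ-fromℕ< i<n) (p (fromℕ< i<n))

  -- For n = 0 the signature lists the atoms true of each triple of positions below m. For n + 1 it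
  -- lists which of the finitely many representatives for n rounds are reachable; a move is answered
  -- by reaching the same representative.
  BF-finite-index : ∀ n m → FiniteIndex n m
  BF-finite-index zero m = BF-finite-index′ zero m sig λ {x} {y} eq i j l i< j< l< t → same x y eq i i< j j< l l< t
    where
    holds? : ∀ t ((a , b) : ℕ × ℕ) i j l → Dec (⟦ Holds t ⟧ ℕ-std (a ∷ b ∷ i ∷ j ∷ l ∷ []))
    holds? t (a , b) i j l = decide (Holds t) (a ∷ b ∷ i ∷ j ∷ l ∷ [])

    bits : ℕ × ℕ → (i j l : Fin m) → Fin 6 → Fin 2
    bits x i j l t = bit (holds? t x (toℕ i) (toℕ j) (toℕ l))

    sig : ℕ × ℕ → Fin ((((2 ^ 6) ^ m) ^ m) ^ m)
    sig x = funToFin {m} λ i → funToFin {m} λ j → funToFin {m} λ l → funToFin (bits x i j l)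

    same : ∀ x y → sig x ≡ sig y → ∀ i → i < m → ∀ j → j < m → ∀ l → l < m → ∀ t →
           (⟦ Holds t ⟧ ℕ-std (proj₁ x ∷ proj₂ x ∷ i ∷ j ∷ l ∷ []) → ⟦ Holds t ⟧ ℕ-std (proj₁ y ∷ proj₂ y ∷ i ∷ j ∷ l ∷ [])) ×
           (⟦ Holds t ⟧ ℕ-std (proj₁ y ∷ proj₂ y ∷ i ∷ j ∷ l ∷ []) → ⟦ Holds t ⟧ ℕ-std (proj₁ x ∷ proj₂ x ∷ i ∷ j ∷ l ∷ []))
    same x y eq = ∀Fin⇒∀< _ λ i → ∀Fin⇒∀< _ λ j → ∀Fin⇒∀< _ λ l t →
      bit-≡ (holds? t x (toℕ i) (toℕ j) (toℕ l)) (holds? t y (toℕ i) (toℕ j) (toℕ l))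
        (funToFin-injective {f = bits x i j l} {bits y i j l}
          (funToFin-injective (funToFin-injective (funToFin-injective eq i) j) l) t)
  BF-finite-index (suc n) m with BF-finite-index n m
  ... | f , covers = BF-finite-index′ (suc n) m sig λ {x} {y} eq →
      (λ z z′ e → answer (same x y eq) z z′ e) ,
      (λ w w′ e → let z , z′ , e′ , p = answer (same y x (sym eq)) w w′ e in z , z′ , e′ , BF-sym ℕ-std n p)
    where
    reach? : ∀ ((a , b) : ℕ × ℕ) c d → Dec (⟦ Reach n ⟧ ℕ-std (m ∷ a ∷ b ∷ c ∷ d ∷ []))
    reach? (a , b) c d = decide (Reach n) (m ∷ a ∷ b ∷ c ∷ d ∷ [])

    sig : ℕ × ℕ → Fin ((2 ^ f) ^ f)
    sig x = funToFin {f} λ c → funToFin {f} λ d → bit (reach? x (toℕ c) (toℕ d))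

    Transfers : ℕ × ℕ → ℕ × ℕ → Set
    Transfers (a , b) (a′ , b′) = ∀ c → c < f → ∀ d → d < f →
      ⟦ Reach n ⟧ ℕ-std (m ∷ a ∷ b ∷ c ∷ d ∷ []) → ⟦ Reach n ⟧ ℕ-std (m ∷ a′ ∷ b′ ∷ c ∷ d ∷ [])

    same : ∀ x y → sig x ≡ sig y → Transfers x y
    same x y eq = ∀Fin⇒∀< _ λ c → ∀Fin⇒∀< _ λ d →
      proj₁ (bit-≡ (reach? x (toℕ c) (toℕ d)) (reach? y (toℕ c) (toℕ d))
        (funToFin-injective (funToFin-injective eq c) d))

    answer : ∀ {a b a′ b′} → Transfers (a , b) (a′ , b′) → ∀ z z′ → ⟦ Ext ⟧ ℕ-std (m ∷ a ∷ b ∷ z ∷ z′ ∷ []) →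
             ∃[ w ] ∃[ w′ ] ⟦ Ext ⟧ ℕ-std (m ∷ a′ ∷ b′ ∷ w ∷ w′ ∷ []) × BFRel ℕ-std n m z z′ w w′
    answer tr z z′ e with covers (z , z′)
    ... | (c , d) , c+d<f , z~c
      with tr c (ℕₚ.≤-<-trans (ℕₚ.m≤m+n c d) c+d<f) d (ℕₚ.≤-<-trans (ℕₚ.m≤n+m d c) c+d<f) (z , z′ , e , z~c)
    ... | w , w′ , e′ , w~c = w , w′ , e′ , BF-trans ℕ-std n z~c (BF-sym ℕ-std n w~c)

  -- A single number x is played as the code x, x of a constant sequence. The representatives found
  -- before need not have this form, so the pigeonhole argument is repeated, the signature of x
  -- being the set of representatives equivalent to it.
  BF-finite-index-diagonal : ∀ n m → ∃[ f ] (∀ x → ∃[ y ] y < f × BFRel ℕ-std n m x x y y)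
  BF-finite-index-diagonal n m with BF-finite-index n m
  ... | f , covers = finite-index id (λ x y → BFRel ℕ-std n m x x y y)
      (λ f x → decide nearD (f ∷ m ∷ x ∷ []))
      (λ f → decide farD (f ∷ m ∷ []))
      (decide (∃F ¬F farD ⟨ x0 ∷ x1 ∷ [] ⟩) (m ∷ []))
      sig (λ {x} {y} → same x y)
    where
    nearD : Fm 3
    nearD = ∃F x0 ≺ x1 ∧F BF n ⟨ x2 ∷ x3 ∷ x3 ∷ x0 ∷ x0 ∷ [] ⟩

    farD : Fm 2
    farD = ∃F ¬F nearD ⟨ x1 ∷ x2 ∷ x0 ∷ [] ⟩

    rep? : ∀ x c d → Dec (BFRel ℕ-std n m x x c d)
    rep? x c d = decide (BF n) (m ∷ x ∷ x ∷ c ∷ d ∷ [])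

    sig : ℕ → Fin ((2 ^ f) ^ f)
    sig x = funToFin {f} λ c → funToFin {f} λ d → bit (rep? x (toℕ c) (toℕ d))

    same : ∀ x y → sig x ≡ sig y → BFRel ℕ-std n m x x y y
    same x y eq with covers (x , x)
    ... | (c , d) , c+d<f , x~c = BF-trans ℕ-std n x~c (BF-sym ℕ-std n
      (∀Fin⇒∀< (λ c → ∀ d → d < f → BFRel ℕ-std n m x x c d → BFRel ℕ-std n m y y c d)
        (λ c → ∀Fin⇒∀< _ λ d → proj₁ (bit-≡ (rep? x (toℕ c) (toℕ d)) (rep? y (toℕ c) (toℕ d))
          (funToFin-injective (funToFin-injective eq c) d)))
        c (ℕₚ.≤-<-trans (ℕₚ.m≤m+n c d) c+d<f) d (ℕₚ.≤-<-trans (ℕₚ.m≤n+m d c) c+d<f) x~c))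

-- Parents and the parity of the depth

-- Parent x m v: m < x is the best accuracy at which x is n-equivalent to a smaller
-- number, and v is the least such number.

Parent : ℕ → Fm 3
Parent n = x1 ≺ x0 ∧F x2 ≺ x0 ∧F BF n ⟨ x1 ∷ x0 ∷ x0 ∷ x2 ∷ x2 ∷ [] ⟩ ∧F
  (∀F x0 ≺ x3 ⇒F ¬F BF n ⟨ x2 ∷ x1 ∷ x1 ∷ x0 ∷ x0 ∷ [] ⟩) ∧F
  (∀F x0 ≺ x1 ⇒F x2 ≺ x0 ⇒F (∀F x0 ≺ x2 ⇒F ¬F BF n ⟨ x1 ∷ x2 ∷ x2 ∷ x0 ∷ x0 ∷ [] ⟩))

-- The parity of the depth in the forest of parents, via a code of the odd-depth
-- numbers up to x.

ParentOutside : ℕ → Fm 3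
ParentOutside n = ∃F ∃F Parent n ⟨ x2 ∷ x1 ∷ x0 ∷ [] ⟩ ∧F ¬F Entry ⟨ x3 ∷ x4 ∷ x0 ∷ `1 ∷ [] ⟩

Kernel : ℕ → Fm 3
Kernel n = ∀F x0 ≺ x3 ⇒F (Entry ⟨ x1 ∷ x2 ∷ x0 ∷ `1 ∷ [] ⟩ ⇔F ParentOutside n ⟨ x0 ∷ x1 ∷ x2 ∷ [] ⟩)

Odd : ℕ → Fm 1
Odd n = ∃F ∃F Kernel n ⟨ x1 ∷ x0 ∷ (`1 `+ x2) ∷ [] ⟩ ∧F Entry ⟨ x1 ∷ x0 ∷ x2 ∷ `1 ∷ [] ⟩

greatest : {P : ℕ → Set} → (∀ m → Dec (P m)) → ∀ {k} n → k < n → P k →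
           ∃[ m ] m < n × P m × (∀ m′ → m′ < n → m < m′ → ¬ P m′)
greatest P? (suc n) k<n p with P? n
... | yes q = n , ℕₚ.≤-refl , q , λ m′ m′<n n<m′ _ → ℕₚ.<⇒≱ n<m′ (ℕₚ.≤-pred m′<n)
... | no ¬q with ℕₚ.m<1+n⇒m<n∨m≡n k<n
...   | inj₂ refl = contradiction p ¬q
...   | inj₁ k<n′ with greatest P? n k<n′ p
...     | m , m<n , q , max = m , ℕₚ.m≤n⇒m≤1+n m<n , q , max′
  where
  max′ : ∀ m′ → m′ < suc n → m < m′ → ¬ _
  max′ m′ m′<n m<m′ r with ℕₚ.m<1+n⇒m<n∨m≡n m′<n
  ... | inj₁ m′<n′ = max m′ m′<n′ m<m′ r
  ... | inj₂ refl = ¬q r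

least : {P : ℕ → Set} → (∀ m → Dec (P m)) → ∀ n → (∃[ k ] k < n × P k) →
        ∃[ m ] m < n × P m × (∀ m′ → m′ < m → ¬ P m′)
least P? (suc n) (k , k<n , p) with ℕₚ.anyUpTo? P? n
... | yes q with least P? n q
...   | m , m<n , r , min = m , ℕₚ.m≤n⇒m≤1+n m<n , r , min
least P? (suc n) (k , k<n , p) | no ¬q with ℕₚ.m<1+n⇒m<n∨m≡n k<n
...   | inj₁ k<n′ = contradiction (k , k<n′ , p) ¬q
...   | inj₂ refl = k , k<n , p , λ m′ m′<k r → ¬q (m′ , m′<k , r)

module ParentProperties (decide : ∀ {k} (φ : Fm k) as → Dec (⟦ φ ⟧ ℕ-std as)) (n : ℕ) where
  open FiniteIndex decide

  IsParent : (x m v : ℕ) → Set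
  IsParent x m v = ⟦ Parent n ⟧ ℕ-std (x ∷ m ∷ v ∷ [])

  parent-unique : ∀ {x m v m′ v′} → IsParent x m v → IsParent x m′ v′ → v ≡ v′
  parent-unique {x} {m} {v} {m′} {v′} (m<x , v<x , e , min , max) (m′<x , v′<x , e′ , min′ , max′) with ℕₚ.<-cmp m m′
  ... | tri< m<m′ _ _ = contradiction e′ (max m′ m′<x m<m′ v′ v′<x)
  ... | tri> _ _ m′<m = contradiction e (max′ m m<x m′<m v v<x)
  ... | tri≈ _ refl _ with ℕₚ.<-cmp v v′
  ...   | tri< v<v′ _ _ = contradiction e (min′ v v<v′)
  ...   | tri≈ _ eq _ = eq
  ...   | tri> _ _ v′<v = contradiction e′ (min v′ v′<v)

  parent-exists : ∀ {x k y} → k < x → y < x → BFRel ℕ-std n k x x y y → ∃[ m ] ∃[ v ] IsParent x m v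
  parent-exists {x} {k} {y} k<x y<x e
    with greatest (λ m → ℕₚ.anyUpTo? (λ v → decide (BF n) (m ∷ x ∷ x ∷ v ∷ v ∷ [])) x) x k<x (y , y<x , e)
  ... | m , m<x , some , max with least (λ v → decide (BF n) (m ∷ x ∷ x ∷ v ∷ v ∷ [])) x some
  ... | v , v<x , e′ , min = m , v , m<x , v<x , e′ , min , λ m′ m′<x m<m′ v′ v′<x e″ → max m′ m′<x m<m′ (v′ , v′<x , e″)

  -- By finite index at accuracy k + 1, every large x is equivalent to a smaller number at that
  -- accuracy, so its best accuracy exceeds k.
  parent-accurate : ∀ k → ∃[ f ] (∀ x → f < x →
    (∃[ m ] ∃[ v ] IsParent x m v) × (∀ m v → IsParent x m v → k < m))
  parent-accurate k with BF-finite-index-diagonal n (suc k)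
  -- Being above f puts the representative below x; being above k + 1 makes k + 1 an accuracy that
  -- `Parent` admits for x.
  ... | f , covers = suc k + f , λ x f<x →
    let y , y<f , e = covers x
        k<x = ℕₚ.≤-<-trans (ℕₚ.m≤m+n (suc k) f) f<x
        y<x = ℕₚ.<-trans y<f (ℕₚ.≤-<-trans (ℕₚ.m≤n+m f (suc k)) f<x)
    in parent-exists k<x y<x e ,
       λ m v (_ , _ , _ , _ , max) → ℕₚ.≰⇒> λ m≤k → max (suc k) k<x (s≤s m≤k) y y<x e

  Mem : (a b u : ℕ) → Set
  Mem a b u = ⟦ Entry ⟧ ℕ-std (a ∷ b ∷ u ∷ 1 ∷ [])

  IsKernel : (a b N : ℕ) → Set
  IsKernel a b N = ⟦ Kernel n ⟧ ℕ-std (a ∷ b ∷ N ∷ [])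

  -- Induction with k as bound: membership of u is determined by that of its parents, which are
  -- smaller than u.
  kernels-agree : ∀ {a b a′ b′ N N′} → IsKernel a b N → IsKernel a′ b′ N′ →
                  ∀ k u → u < k → u < N → u < N′ → (Mem a b u → Mem a′ b′ u) × (Mem a′ b′ u → Mem a b u)
  kernels-agree κ κ′ (suc k) u u<k u<N u<N′ =
    (λ p → let m , v , par , ¬q = proj₁ (κ u u<N) p in
           proj₂ (κ′ u u<N′) (m , v , par , ¬q ∘ proj₂ (ih v (proj₁ (proj₂ par))))) ,
    (λ p → let m , v , par , ¬q = proj₁ (κ′ u u<N′) p in
           proj₂ (κ u u<N) (m , v , par , ¬q ∘ proj₁ (ih v (proj₁ (proj₂ par)))))
    where
    ih : ∀ v → v < u → _
    ih v v<u = kernels-agree κ κ′ k v (ℕₚ.<-≤-trans v<u (ℕₚ.≤-pred u<k)) (ℕₚ.<-trans v<u u<N) (ℕₚ.<-trans v<u u<N′)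

  -- The old code is copied below N and the bit at N is computed from it. The condition at any u up
  -- to N looks only at parents below N, where both codes have the same members.
  kernel-exists : ∀ N → ∃[ a ] ∃[ b ] IsKernel a b N
  kernel-exists zero = 0 , 0 , λ _ ()
  kernel-exists (suc N) with kernel-exists N
  ... | a , b , κ = a′ , b′ , κ′
    where
    outside? = decide (ParentOutside n) (N ∷ a ∷ b ∷ [])

    top : Dec (⟦ ParentOutside n ⟧ ℕ-std (N ∷ a ∷ b ∷ [])) → ℕ
    top (yes _) = 1
    top (no _)  = 0

    g : ℕ → ℕ
    g u with u ℕₚ.≟ N
    ... | yes _ = top outside?
    ... | no _  = entry a b u

    code = β-lemma g (suc N)
    a′ = proj₁ code
    b′ = proj₁ (proj₂ code)

    g-< : ∀ {u} → u < N → g u ≡ entry a b u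
    g-< {u} u<N with u ℕₚ.≟ N
    ... | yes refl = contradiction u<N (ℕₚ.<-irrefl refl)
    ... | no _ = refl

    g-N : g N ≡ top outside?
    g-N with N ℕₚ.≟ N
    ... | yes _ = refl
    ... | no N≢N = contradiction refl N≢N

    Mem⇒g≡1 : ∀ {u} → u < suc N → Mem a′ b′ u → 1 ≡ g u
    Mem⇒g≡1 {u} u<N p = Entry-unique {a′} {b′} {u} p (proj₂ (proj₂ code) u u<N)

    g≡1⇒Mem : ∀ {u} → u < suc N → g u ≡ 1 → Mem a′ b′ u
    g≡1⇒Mem {u} u<N eq = subst (λ v → ⟦ Entry ⟧ ℕ-std (a′ ∷ b′ ∷ u ∷ v ∷ [])) eq (proj₂ (proj₂ code) u u<N)

    old⇒new : ∀ {u} → u < N → Mem a b u → Mem a′ b′ u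
    old⇒new {u} u<N p = g≡1⇒Mem (ℕₚ.m≤n⇒m≤1+n u<N) (trans (g-< u<N) (sym (Entry⇒entry {a} {b} {u} p)))

    new⇒old : ∀ {u} → u < N → Mem a′ b′ u → Mem a b u
    new⇒old {u} u<N p = subst (λ v → ⟦ Entry ⟧ ℕ-std (a ∷ b ∷ u ∷ v ∷ []))
      (trans (sym (g-< u<N)) (sym (Mem⇒g≡1 (ℕₚ.m≤n⇒m≤1+n u<N) p))) (Entry-entry a b u)

    top⇒ : ∀ o → 1 ≡ top o → ⟦ ParentOutside n ⟧ ℕ-std (N ∷ a ∷ b ∷ [])
    top⇒ (yes p) _ = p

    ⇒top : ∀ o → ⟦ ParentOutside n ⟧ ℕ-std (N ∷ a ∷ b ∷ []) → top o ≡ 1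
    ⇒top (yes _) _ = refl
    ⇒top (no ¬p) p = contradiction p ¬p

    κ′ : IsKernel a′ b′ (suc N)
    κ′ u u<1+N with ℕₚ.m<1+n⇒m<n∨m≡n u<1+N
    ... | inj₁ u<N =
      (λ p → let m , v , par , ¬q = proj₁ (κ u u<N) (new⇒old u<N p) in
             m , v , par , ¬q ∘ new⇒old (ℕₚ.<-trans (proj₁ (proj₂ par)) u<N)) ,
      (λ (m , v , par , ¬q) → old⇒new u<N (proj₂ (κ u u<N)
             (m , v , par , ¬q ∘ old⇒new (ℕₚ.<-trans (proj₁ (proj₂ par)) u<N))))
    ... | inj₂ refl =
      (λ p → let m , v , par , ¬q = top⇒ outside? (trans (Mem⇒g≡1 u<1+N p) g-N) in
             m , v , par , ¬q ∘ new⇒old (proj₁ (proj₂ par))) ,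
      (λ (m , v , par , ¬q) → g≡1⇒Mem u<1+N (trans g-N (⇒top outside?
             (m , v , par , ¬q ∘ old⇒new (proj₁ (proj₂ par))))))

  IsOdd : ℕ → Set
  IsOdd x = ⟦ Odd n ⟧ ℕ-std (x ∷ [])

  -- In a kernel that reaches x, x is a member exactly when its unique parent v is not. By
  -- `kernels-agree` the kernels named in `Odd` give the same answer.
  parent-parity : ∀ {x m v} → IsParent x m v → ¬ ((IsOdd x → IsOdd v) × (IsOdd v → IsOdd x))
  parent-parity {x} {m} {v} par (x⇒v , v⇒x) with kernel-exists (suc x)
  ... | a , b , κ = contra (decide Entry (a ∷ b ∷ v ∷ 1 ∷ []))
    where
    v<x : v < x
    v<x = proj₁ (proj₂ par)

    κᵥ : IsKernel a b (suc v)
    κᵥ u u<1+v = κ u (ℕₚ.m≤n⇒m≤1+n (ℕₚ.≤-trans u<1+v v<x))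

    contra : ¬ Dec (Mem a b v)
    contra (yes p) =
      let a′ , b′ , κ′ , p′ = v⇒x (a , b , κᵥ , p)
          m′ , v′ , par′ , ¬q = proj₁ (κ x ℕₚ.≤-refl)
            (proj₂ (kernels-agree κ κ′ (suc x) x ℕₚ.≤-refl ℕₚ.≤-refl ℕₚ.≤-refl) p′)
      in ¬q (subst (Mem a b) (parent-unique par par′) p)
    contra (no ¬p) =
      let a′ , b′ , κ′ , p′ = x⇒v (a , b , κ , proj₂ (κ x ℕₚ.≤-refl) (m , v , par , ¬p))
      in ¬p (proj₂ (kernels-agree κᵥ κ′ (suc v) v ℕₚ.≤-refl ℕₚ.≤-refl ℕₚ.≤-refl) p′)

-- Back-and-forth at infinite accuracy

double odd : ℕ → ℕ
double p = p + p
odd p = suc (p + p)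

double-injective : ∀ {p q} → p + p ≡ q + q → p ≡ q
double-injective {p} {q} eq = trans (ℕₚ.n≡⌊n+n/2⌋ p) (trans (cong ⌊_/2⌋ eq) (sym (ℕₚ.n≡⌊n+n/2⌋ q)))

double≢odd : ∀ p q → ¬ p + p ≡ q + q + 1
double≢odd (suc p) zero eq with trans (sym (ℕₚ.+-suc p p)) (ℕₚ.suc-injective eq)
... | ()
double≢odd (suc p) (suc q) eq = double≢odd p q (ℕₚ.suc-injective (ℕₚ.suc-injective
  (trans (cong suc (sym (ℕₚ.+-suc p p))) (trans eq (cong (λ z → suc z + 1) (ℕₚ.+-suc q q))))))

totality : Fm 0
totality = ∀F ∀F ∀F ∃F Entry ⟨ x3 ∷ x2 ∷ x1 ∷ x0 ∷ [] ⟩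

uniqueness : Fm 0
uniqueness = ∀F ∀F ∀F ∀F ∀F Entry ⟨ x4 ∷ x3 ∷ x2 ∷ x1 ∷ [] ⟩ ⇒F Entry ⟨ x4 ∷ x3 ∷ x2 ∷ x0 ∷ [] ⟩ ⇒F x1 ≐ x0

constancy : Fm 0
constancy = ∀F ∀F Entry ⟨ x1 ∷ x1 ∷ x0 ∷ x1 ∷ [] ⟩

extendability : Fm 0
extendability = ∀F ∀F ∀F ∃F ∃F Ext ⟨ x4 ∷ x3 ∷ x2 ∷ x1 ∷ x0 ∷ [] ⟩

-- For every m, a, b, c, d, p, v with Ext m a b c d, the entry of c, d at position 2 p + 1
-- can be changed to v without losing Ext or changing the other odd entries below 2 m.
updatability : Fm 0
updatability = ∀F ∀F ∀F ∀F ∀F ∀F ∀F Ext ⟨ x6 ∷ x5 ∷ x4 ∷ x3 ∷ x2 ∷ [] ⟩ ⇒F (∃F ∃F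
  Ext ⟨ x8 ∷ x7 ∷ x6 ∷ x1 ∷ x0 ∷ [] ⟩ ∧F
  Entry ⟨ x1 ∷ x0 ∷ ((x3 `+ x3) `+ `1) ∷ x2 ∷ [] ⟩ ∧F
  (∀F ∀F x1 ≺ x10 ⇒F ¬F (x1 ≐ x5) ⇒F Entry ⟨ x7 ∷ x6 ∷ ((x1 `+ x1) `+ `1) ∷ x0 ∷ [] ⟩ ⇒F
    Entry ⟨ x3 ∷ x2 ∷ ((x1 `+ x1) `+ `1) ∷ x0 ∷ [] ⟩))
  where
  x10 : ∀ {k} → Term (11 + k)
  x10 = var (suc (suc (suc (suc (suc (suc (suc (suc (suc (suc zero))))))))))

-- The modulus 1 + (1 + i) x exceeds x, so x is its own remainder.
ℕ-constancy : sem constancy ℕ-std (emptyEnv ℕ-std)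
ℕ-constancy x i = s≤s (ℕₚ.m≤m+n x (i * x)) , 0 , sym (ℕₚ.+-identityʳ x)

ℕ-extendability : sem extendability ℕ-std (emptyEnv ℕ-std)
ℕ-extendability m a b with β-lemma (λ k → entry a b ⌊ k /2⌋) (m + m)
... | c , d , code = c , d , λ i i<m → entry a b i , Entry-entry a b i ,
  subst (λ k → ⟦ Entry ⟧ ℕ-std (c ∷ d ∷ (i + i) ∷ entry a b k ∷ [])) (sym (ℕₚ.n≡⌊n+n/2⌋ i))
    (code (i + i) (ℕₚ.+-mono-< i<m i<m))

ℕ-updatability : sem updatability ℕ-std (emptyEnv ℕ-std)
ℕ-updatability m a b c d p v ext = c′ , d′ , ext′ , here , elsewhere
  where
  g : ℕ → ℕ
  g k with k ℕₚ.≟ p + p + 1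
  ... | yes _ = v
  ... | no _  = entry c d k

  g-here : g (p + p + 1) ≡ v
  g-here with p + p + 1 ℕₚ.≟ p + p + 1
  ... | yes _ = refl
  ... | no ≢ = contradiction refl ≢

  g-elsewhere : ∀ {k} → ¬ k ≡ p + p + 1 → g k ≡ entry c d k
  g-elsewhere {k} k≢ with k ℕₚ.≟ p + p + 1
  ... | yes eq = contradiction eq k≢
  ... | no _ = refl

  N : ℕ
  -- Long enough for all positions below 2 m and also for position 2 p + 1, as p may be m or more.
  N = m + m + suc (p + p + 1)
  code : ∃[ c′ ] ∃[ d′ ] (∀ i → i < N → ⟦ Entry ⟧ ℕ-std (c′ ∷ d′ ∷ i ∷ g i ∷ []))
  code = β-lemma g N
  c′ d′ : ℕ
  c′ = proj₁ code
  d′ = proj₁ (proj₂ code)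

  copy : ∀ {k w} → k < m + m → ¬ k ≡ p + p + 1 →
         ⟦ Entry ⟧ ℕ-std (c ∷ d ∷ k ∷ w ∷ []) → ⟦ Entry ⟧ ℕ-std (c′ ∷ d′ ∷ k ∷ w ∷ [])
  copy {k} {w} k< k≢ e = subst (λ w → ⟦ Entry ⟧ ℕ-std (c′ ∷ d′ ∷ k ∷ w ∷ []))
    (trans (g-elsewhere k≢) (sym (Entry⇒entry {c} {d} {k} e)))
    (proj₂ (proj₂ code) k (ℕₚ.≤-trans k< (ℕₚ.m≤m+n (m + m) _)))

  ext′ : ⟦ Ext ⟧ ℕ-std (m ∷ a ∷ b ∷ c′ ∷ d′ ∷ [])
  ext′ i i<m = let w , e , e′ = ext i i<m in
    w , e , copy {i + i} {w} (ℕₚ.+-mono-< i<m i<m) (double≢odd i p) e′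

  here : ⟦ Entry ⟧ ℕ-std (c′ ∷ d′ ∷ (p + p + 1) ∷ v ∷ [])
  here = subst (λ w → ⟦ Entry ⟧ ℕ-std (c′ ∷ d′ ∷ (p + p + 1) ∷ w ∷ [])) g-here
    (proj₂ (proj₂ code) (p + p + 1) (ℕₚ.m≤n+m (suc (p + p + 1)) (m + m)))

  elsewhere : ∀ q w → q < m → ¬ q ≡ p → ⟦ Entry ⟧ ℕ-std (c ∷ d ∷ (q + q + 1) ∷ w ∷ []) →
              ⟦ Entry ⟧ ℕ-std (c′ ∷ d′ ∷ (q + q + 1) ∷ w ∷ [])
  elsewhere q w q<m q≢p = copy {q + q + 1} {w} q+q+1<m+m
    (λ eq → q≢p (double-injective (ℕₚ.+-cancelʳ-≡ 1 (q + q) (p + p) eq)))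
    where
    q+q+1<m+m : q + q + 1 < m + m
    q+q+1<m+m = subst (_≤ m + m) (trans (cong suc (ℕₚ.+-suc q q)) (cong suc (ℕₚ.+-comm 1 (q + q)))) (ℕₚ.+-mono-≤ q<m q<m)

-- Coded tuples and moves in M

module Game (M : Structure) (ta : ModelOfTA M) (m : Carrier M) (inf : Transfer.Infinite M ta m) where
  open Transfer M ta

  C : Set
  C = Carrier M

  -- The record wrapper lets the code, position and value be inferred from the type of a proof.
  record _∣_⊢_↦_ (a b : C) (p : ℕ) (v : C) : Set where
    constructor ↦-in
    field ↦-out : ⟦ Entry ⟧ M (a ∷ b ∷ ι p ∷ v ∷ [])

  record Extends (a b c d : C) : Set where
    constructor ext-in
    field ext-out : ⟦ Ext ⟧ M (m ∷ a ∷ b ∷ c ∷ d ∷ [])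

  open _∣_⊢_↦_
  open Extends

  ↦-total : ∀ a b p → Σ[ v ∈ C ] a ∣ b ⊢ p ↦ v
  ↦-total a b p = let v , s = transfer totality (λ a b i → entry a b i , Entry-entry a b i) a b (ι p) in v , ↦-in s

  entry-unique : ∀ a b i v w → ⟦ Entry ⟧ M (a ∷ b ∷ i ∷ v ∷ []) → ⟦ Entry ⟧ M (a ∷ b ∷ i ∷ w ∷ []) → v ≡ w
  entry-unique = transfer uniqueness (λ a b i v w → Entry-unique {a} {b} {i} {v} {w})

  ↦-constant : ∀ x p → x ∣ x ⊢ p ↦ x
  ↦-constant x p = ↦-in (transfer constancy ℕ-constancy x (ι p))

  extend : ∀ a b → Σ[ c ∈ C ] Σ[ d ∈ C ] Extends a b c d
  extend a b = let c , d , e = transfer extendability ℕ-extendability m a b in c , d , ext-in e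

  ι-odd : ∀ p → ι (odd p) ≡ _+ᴹ_ M (_+ᴹ_ M (ι p) (ι p)) (oneᴹ M)
  ι-odd p = cong (λ z → _+ᴹ_ M z (oneᴹ M)) (ι-+ p p)

  ι-injective : ∀ {p q} → ι p ≡ ι q → p ≡ q
  ι-injective {p} {q} = from (transferFO (x0 `≈ x1) (lookup (p ∷ q ∷ [])))

  update : ∀ {a b c d} p v → Extends a b c d → Σ[ c′ ∈ C ] Σ[ d′ ∈ C ] Extends a b c′ d′ ×
           c′ ∣ d′ ⊢ odd p ↦ v × (∀ q w → ¬ q ≡ p → c ∣ d ⊢ odd q ↦ w → c′ ∣ d′ ⊢ odd q ↦ w)
  update {a} {b} {c} {d} p v e =
    let c′ , d′ , e′ , here , elsewhere = transfer updatability ℕ-updatability m a b c d (ι p) v (ext-out e)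
    in c′ , d′ , ext-in e′ , ↦-in (at c′ d′ v (sym (ι-odd p)) here) ,
       λ q w q≢p s → ↦-in (at c′ d′ w (sym (ι-odd q))
         (elsewhere (ι q) w (inf q) (q≢p ∘ ι-injective) (at c d w (ι-odd q) (↦-out s))))
    where
    at : ∀ c d v {i i′} → i ≡ i′ → ⟦ Entry ⟧ M (c ∷ d ∷ i ∷ v ∷ []) → ⟦ Entry ⟧ M (c ∷ d ∷ i′ ∷ v ∷ [])
    at c d v refl s = s

  -- Every standard position lies below the infinite accuracy m, so `Ext` applies to it.
  ↦-extends : ∀ {a b c d p v} → Extends a b c d → a ∣ b ⊢ p ↦ v → c ∣ d ⊢ double p ↦ v
  ↦-extends {a} {b} {c} {d} {p} {v} e s =
    let w , s′ , s″ = ext-out e (ι p) (inf p)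
    in ↦-in (subst₂ (λ i v → ⟦ Entry ⟧ M (c ∷ d ∷ i ∷ v ∷ [])) (sym (ι-+ p p))
         (entry-unique a b (ι p) w v s′ (↦-out s)) s″)

  -- The β-lemma codes sequences of natural numbers only. A tuple from M is written entry by entry,
  -- the first one last, by the transferred `updatability`.
  store : ∀ a b {j} (ys : Fin j → C) o → Σ[ c ∈ C ] Σ[ d ∈ C ] Extends a b c d ×
          (∀ l → c ∣ d ⊢ odd (o + toℕ l) ↦ ys l)
  store a b {zero}  ys o = let c , d , e = extend a b in c , d , e , λ ()
  store a b {suc j} ys o =
    let c , d , e , stored = store a b (ys ∘ suc) (suc o)
        c′ , d′ , e′ , here , elsewhere = update o (ys zero) e
    in c′ , d′ , e′ , λ where
      zero    → subst (λ p → c′ ∣ d′ ⊢ odd p ↦ ys zero) (sym (ℕₚ.+-identityʳ o)) here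
      (suc l) → subst (λ p → c′ ∣ d′ ⊢ odd p ↦ ys (suc l)) (sym (ℕₚ.+-suc o (toℕ l)))
        (elsewhere (suc o + toℕ l) (ys (suc l)) (λ eq → ℕₚ.m≢1+m+n o (sym eq)) (stored l))

  atoms : ∀ {a b c d} → BFRel M 0 m a b c d → ∀ t {i j l u v w u′ v′ w′} →
          a ∣ b ⊢ i ↦ u → a ∣ b ⊢ j ↦ v → a ∣ b ⊢ l ↦ w → c ∣ d ⊢ i ↦ u′ → c ∣ d ⊢ j ↦ v′ → c ∣ d ⊢ l ↦ w′ →
          AtomRel M t u v w → AtomRel M t u′ v′ w′
  atoms {c = c} {d} e t {i} {j} {l} {u} {v} {w} {u′} {v′} {w′} su sv sw su′ sv′ sw′ r =
    let u″ , v″ , w″ , su″ , sv″ , sw″ , r″ = proj₁ (e (ι i) (ι j) (ι l) (inf i) (inf j) (inf l) t)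
          (u , v , w , ↦-out su , ↦-out sv , ↦-out sw , r)
    in AtomRel-cong (entry-unique c d (ι i) u″ u′ su″ (↦-out su′)) (entry-unique c d (ι j) v″ v′ sv″ (↦-out sv′))
         (entry-unique c d (ι l) w″ w′ sw″ (↦-out sw′)) r″
    where
    AtomRel-cong : ∀ {u v w u′ v′ w′} → u ≡ u′ → v ≡ v′ → w ≡ w′ → AtomRel M t u v w → AtomRel M t u′ v′ w′
    AtomRel-cong refl refl refl r = r

  Codes : ∀ {k} → (a b : C) → (Fin k → ℕ) → Env M k → Set
  Codes a b pos ρ = ∀ i → a ∣ b ⊢ pos i ↦ ρ i

  Codes-double : ∀ {k a b c d} {pos : Fin k → ℕ} {ρ} → Extends a b c d → Codes a b pos ρ → Codes c d (double ∘ pos) ρ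
  Codes-double e κ i = ↦-extends e (κ i)

  -- Terms and quantifier-free formulas

  subterms : ∀ {k} → Term k → ℕ
  subterms (var i)  = 0
  subterms `0       = 0
  subterms `1       = 0
  subterms (s `+ t) = suc (subterms s) + suc (subterms t)
  subterms (s `* t) = suc (subterms s) + suc (subterms t)

  values : ∀ {k} → Env M k → (t : Term k) → Fin (suc (subterms t)) → C
  values ρ t zero = evalT M ρ t
  values ρ (s `+ t) (suc l) = extN (suc (subterms s)) (values ρ s) (values ρ t) l
  values ρ (s `* t) (suc l) = extN (suc (subterms s)) (values ρ s) (values ρ t) l

  extN-↑ˡ : ∀ j {k} {ys : Fin j → C} {xs : Fin k → C} l → extN j ys xs (l ↑ˡ k) ≡ ys l
  extN-↑ˡ j {k} {ys} {xs} l = cong [ ys , xs ]′ (Finₚ.splitAt-↑ˡ j l k)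

  extN-↑ʳ : ∀ j {k} {ys : Fin j → C} {xs : Fin k → C} l → extN j ys xs (j ↑ʳ l) ≡ xs l
  extN-↑ʳ j {k} {ys} {xs} l = cong [ ys , xs ]′ (Finₚ.splitAt-↑ʳ j k l)

  module _ {a b} j {k} (ys : Fin j → C) (xs : Fin k → C) (pos : Fin (j + k) → ℕ) (κ : Codes a b pos (extN j ys xs)) where

    Codes-left : Codes a b (λ l → pos (l ↑ˡ k)) ys
    Codes-left l = subst (λ v → a ∣ b ⊢ _ ↦ v) (extN-↑ˡ j l) (κ (l ↑ˡ k))

    Codes-right : Codes a b (λ l → pos (j ↑ʳ l)) xs
    Codes-right l = subst (λ v → a ∣ b ⊢ _ ↦ v) (extN-↑ʳ j l) (κ (j ↑ʳ l))

  module _ {a b c d} (e : BFRel M 0 m a b c d) {k} {pos : Fin k → ℕ} {ρ ρ′ : Env M k}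
           (κ : Codes a b pos ρ) (κ′ : Codes c d pos ρ′) where

    -- The answer to a move need not visibly store values of subterms. By induction on t it does:
    -- whatever sits at a position satisfies the same atoms as the stored value, and these fix it
    -- from the entries for the immediate subterms.
    term-value : ∀ t (loc : Fin (suc (subterms t)) → ℕ) → Codes a b loc (values ρ t) → c ∣ d ⊢ loc zero ↦ evalT M ρ′ t
    term-value t loc stored with ↦-total c d (loc zero)
    ... | w , s = subst (λ v → c ∣ d ⊢ loc zero ↦ v) (w≡ t loc stored s) s
      where
      w≡ : ∀ t (loc : Fin (suc (subterms t)) → ℕ) → Codes a b loc (values ρ t) →
           ∀ {w} → c ∣ d ⊢ loc zero ↦ w → w ≡ evalT M ρ′ t
      w≡ (var i) loc st s = atoms e is≈ (st zero) (κ i) (st zero) s (κ′ i) s refl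
      w≡ `0 loc st s = atoms e is0 (st zero) (st zero) (st zero) s s s refl
      w≡ `1 loc st s = atoms e is1 (st zero) (st zero) (st zero) s s s refl
      w≡ (t `+ u) loc st s =
        let stˡ = Codes-left (suc (subterms t)) (values ρ t) (values ρ u) (loc ∘ suc) (st ∘ suc)
            stʳ = Codes-right (suc (subterms t)) (values ρ t) (values ρ u) (loc ∘ suc) (st ∘ suc)
        in sym (atoms e is+ (stˡ zero) (stʳ zero) (st zero) (term-value t _ stˡ) (term-value u _ stʳ) s refl)
      w≡ (t `* u) loc st s =
        let stˡ = Codes-left (suc (subterms t)) (values ρ t) (values ρ u) (loc ∘ suc) (st ∘ suc)
            stʳ = Codes-right (suc (subterms t)) (values ρ t) (values ρ u) (loc ∘ suc) (st ∘ suc)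
        in sym (atoms e is* (stˡ zero) (stʳ zero) (st zero) (term-value t _ stˡ) (term-value u _ stʳ) s refl)

  -- The one round is spent on storing the values of all subterms of s and t.
  atomic : ∀ {a b c d} → BFRel M 1 m a b c d → ∀ {k} {pos : Fin k → ℕ} {ρ ρ′} →
           Codes a b pos ρ → Codes c d pos ρ′ → ∀ s t →
           (evalT M ρ s ≡ evalT M ρ t ⇔ evalT M ρ′ s ≡ evalT M ρ′ t) ×
           (_<ᴹ_ M (evalT M ρ s) (evalT M ρ t) ⇔ _<ᴹ_ M (evalT M ρ′ s) (evalT M ρ′ t))
  atomic {a} {b} (forth , _) {ρ = ρ} κ κ′ s t =
    let z , z′ , ext , stored = store a b (extN (suc (subterms s)) (values ρ s) (values ρ t)) 0
        w , w′ , ext′ , e = forth z z′ (ext-out ext)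
        stˡ = Codes-left (suc (subterms s)) (values ρ s) (values ρ t) (odd ∘ toℕ) stored
        stʳ = Codes-right (suc (subterms s)) (values ρ s) (values ρ t) (odd ∘ toℕ) stored
        κ₂ = Codes-double ext κ
        κ₂′ = Codes-double (ext-in ext′) κ′
    in compare e (stˡ zero) (stʳ zero) (term-value e κ₂ κ₂′ s _ stˡ) (term-value e κ₂ κ₂′ t _ stʳ)
    where
    compare : ∀ {z z′ w w′ p q u v u′ v′} → BFRel M 0 m z z′ w w′ →
              z ∣ z′ ⊢ p ↦ u → z ∣ z′ ⊢ q ↦ v → w ∣ w′ ⊢ p ↦ u′ → w ∣ w′ ⊢ q ↦ v′ →
              (u ≡ v ⇔ u′ ≡ v′) × (_<ᴹ_ M u v ⇔ _<ᴹ_ M u′ v′)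
    compare {z} {z′} {w} {w′} e su sv su′ sv′ =
      mk⇔ (atoms e is≈ su sv su su′ sv′ su′) (atoms e⁻¹ is≈ su′ sv′ su′ su sv su) ,
      mk⇔ (atoms e is< su sv su su′ sv′ su′) (atoms e⁻¹ is< su′ sv′ su′ su sv su)
      where
      e⁻¹ : BFRel M 0 m w w′ z z′
      e⁻¹ = BF-sym M 0 e

  SatQF-BF : ∀ r {a b c d} → BFRel M (suc r) m a b c d → ∀ {k} {pos : Fin k → ℕ} {ρ ρ′} →
             Codes a b pos ρ → Codes c d pos ρ′ → ∀ θ → SatQF M θ ρ ⇔ SatQF M θ ρ′
  SatQF-BF zero    e κ κ′ (s `≈ t) = proj₁ (atomic e κ κ′ s t)
  SatQF-BF zero    e κ κ′ (s `< t) = proj₂ (atomic e κ κ′ s t)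
  SatQF-BF zero    e κ κ′ (`¬ θ)   = →-cong-⇔ (SatQF-BF zero e κ κ′ θ) (mk⇔ id id)
  SatQF-BF zero    e κ κ′ (θ `∧ η) = SatQF-BF zero e κ κ′ θ ×-⇔ SatQF-BF zero e κ κ′ η
  SatQF-BF zero    e κ κ′ (θ `∨ η) = SatQF-BF zero e κ κ′ θ ⊎-⇔ SatQF-BF zero e κ κ′ η
  -- Surplus rounds are used up by moves that only carry the old entries along.
  SatQF-BF (suc r) {a} {b} (forth , _) κ κ′ θ =
    let z , z′ , ext = extend a b
        w , w′ , ext′ , e = forth z z′ (ext-out ext)
    in SatQF-BF r e (Codes-double ext κ) (Codes-double (ext-in ext′) κ′) θ

  -- Infinitary formulas of finite rank

  block : ∀ j {k} → (Fin k → ℕ) → Fin (j + k) → ℕ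
  block j pos = [ odd ∘ toℕ , double ∘ pos ]′ ∘ splitAt j

  Codes-block : ∀ {a b c d} j {k} {ys : Fin j → C} {pos : Fin k → ℕ} {ρ} → Extends a b c d → Codes a b pos ρ →
                (∀ l → c ∣ d ⊢ odd (toℕ l) ↦ ys l) → Codes c d (block j pos) (extN j ys ρ)
  Codes-block j ext κ stored i with splitAt j i
  ... | inj₁ l = stored l
  ... | inj₂ l = Codes-double ext κ l

  descend : ∀ {α β r} → β <o α → α <o fin (suc r) → Σ[ r′ ∈ ℕ ] r ≡ suc r′ × β <o fin (suc r′)
  descend {r = suc r} (fin<fin p) (fin<fin q) = r , refl , fin<fin (ℕₚ.≤-trans p (ℕₚ.≤-pred q))
  descend {r = zero} (fin<fin {m} {suc n} p) (fin<fin (s≤s ()))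

  -- One round for each level of the formula and a last one for its terms. A whole quantifier block
  -- is a single move, whatever its length.
  SatΣ-BF : ∀ {α k} (φ : Σin α k) r → α <o fin (suc r) → ∀ {a b c d} → BFRel M (suc r) m a b c d →
            ∀ {pos : Fin k → ℕ} {ρ ρ′} → Codes a b pos ρ → Codes c d pos ρ′ → SatΣ M φ ρ → SatΣ M φ ρ′
  SatΠ-BF : ∀ {α k} (φ : Πin α k) r → α <o fin (suc r) → ∀ {a b c d} → BFRel M (suc r) m a b c d →
            ∀ {pos : Fin k → ℕ} {ρ ρ′} → Codes a b pos ρ → Codes c d pos ρ′ → SatΠ M φ ρ → SatΠ M φ ρ′
  Sat∃-BF : ∀ {α k} j (φ : Πin α (j + k)) r → α <o fin (suc r) → ∀ {a b c d} → BFRel M (suc (suc r)) m a b c d →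
            ∀ {pos : Fin k → ℕ} {ρ ρ′} → Codes a b pos ρ → Codes c d pos ρ′ →
            ∀ ys → SatΠ M φ (extN j ys ρ) → Σ[ ys′ ∈ (Fin j → C) ] SatΠ M φ (extN j ys′ ρ′)

  SatΣ-BF (σqf θ) r _ e κ κ′ = to (SatQF-BF r e κ κ′ θ)
  SatΣ-BF (⋁∃ β β<α j φ) r α<r e κ κ′ (i , ys , s) with descend (β<α i) α<r
  ... | r′ , refl , β<r′ = i , Sat∃-BF (j i) (φ i) r′ β<r′ e κ κ′ ys s

  SatΠ-BF (πqf θ) r _ e κ κ′ = to (SatQF-BF r e κ κ′ θ)
  SatΠ-BF (⋀∀ β β<α j φ) r α<r {a} {b} {c} {d} (_ , back) κ κ′ s i ys with descend (β<α i) α<r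
  ... | r′ , refl , β<r′ =
    let w , w′ , ext′ , stored = store c d ys 0
        z , z′ , ext , e = back w w′ (ext-out ext′)
        -- The answering tuple is read off at the positions where `ys` was stored.
        ys′ = λ l → ↦-total z z′ (odd (toℕ l))
    in SatΣ-BF (φ i) r′ β<r′ e (Codes-block (j i) (ext-in ext) κ (proj₂ ∘ ys′)) (Codes-block (j i) ext′ κ′ stored)
         (s i (proj₁ ∘ ys′))

  Sat∃-BF j φ r α<r {a} {b} (forth , _) κ κ′ ys s =
    let z , z′ , ext , stored = store a b ys 0
        w , w′ , ext′ , e = forth z z′ (ext-out ext)
        ys′ = λ l → ↦-total w w′ (odd (toℕ l))
    in proj₁ ∘ ys′ , SatΠ-BF φ r α<r e (Codes-block j ext κ stored) (Codes-block j (ext-in ext′) κ′ (proj₂ ∘ ys′)) s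

-- The twin of an infinite element and the Scott rank

finite-rank : ∀ {α} → α <o ω → Σ[ r ∈ ℕ ] α <o fin (suc r)
finite-rank fin<ω = _ , fin<fin ℕₚ.≤-refl

accurate-parents : ℕ → Fm 2
accurate-parents n = ∀F x1 ≺ x0 ⇒F
  ((∃F ∃F Parent n ⟨ x2 ∷ x1 ∷ x0 ∷ [] ⟩) ∧F (∀F ∀F Parent n ⟨ x2 ∷ x1 ∷ x0 ∷ [] ⟩ ⇒F x4 ≺ x1))

parents-alternate : ℕ → Fm 0
parents-alternate n = ∀F ∀F ∀F Parent n ⟨ x2 ∷ x1 ∷ x0 ∷ [] ⟩ ⇒F
  ¬F (Odd n ⟨ x2 ∷ [] ⟩ ⇔F Odd n ⟨ x0 ∷ [] ⟩)

module _ (M : Structure) (ta : ModelOfTA M) (∞ : Carrier M) (inf : Transfer.Infinite M ta ∞) where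
  open Transfer M ta
  open Decide M ta ∞ inf

  twin : ∀ n → Σ[ m ∈ Carrier M ] Σ[ b ∈ Carrier M ] Infinite m × BFRel M n m ∞ ∞ b b ×
         Σ[ χ ∈ FO 1 ] ¬ (SatFO M χ (λ _ → ∞) ⇔ SatFO M χ (λ _ → b))
  twin n =
    -- Existence at k = 0 fixes one parent b of ∞; the bound for every k then applies to this same
    -- parent, so m is infinite.
    let m , b , par = proj₁ (accurate 0)
    in m , b , (λ k → proj₂ (accurate k) m b par) , proj₁ (proj₂ (proj₂ par)) , form (Odd n) ,
       λ iff → let iff′ = ⇔-trans (⇔-sym (ok (Odd n) M (λ _ → ∞))) (⇔-trans iff (ok (Odd n) M (λ _ → b)))
               in transfer (parents-alternate n) (λ x m v → parent-parity) ∞ m b par (to iff′ , from iff′)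
    where
    open ParentProperties decide n
    accurate : ∀ k → _
    accurate k = let f , acc = parent-accurate k in
      to (transferAt (accurate-parents n) (lookup (f ∷ k ∷ []))) acc ∞ (inf f)

theorem1p7 : (M : Structure) → Countable M → ModelOfTA M → NonStandard M → ScottRank>ω M
theorem1p7 M _ ta (∞ , ∞≢) definable with definable 1 (λ _ → ∞)
... | ⋁∃ β β<ω j ψ , defines =
  let i , ys , s = from (defines (λ _ → ∞)) (idAut M , λ _ → refl)
      r , β<r = finite-rank (β<ω i)
      -- One round for the outer existential block, and r + 1 for the formula under it.
      m , b , m-inf , e , χ , ∞≢b = twin M ta ∞ (Transfer.nonstandard⇒infinite M ta ∞≢) (suc (suc r))
      constant = Game.↦-constant M ta m m-inf
      -- The free variable is read at position 0 of the constant sequences coded by ∞, ∞ and b, b.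
      s′ = Game.Sat∃-BF M ta m m-inf (j i) (ψ i) r β<r e {pos = λ _ → 0} (λ _ → constant ∞ 0) (λ _ → constant b 0) ys s
      f , f∞≡b = to (defines (λ _ → b)) (i , s′)
  in ∞≢b (SatFO-aut M f f∞≡b χ)
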